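{- Let $k\geq 1$ and $p\geq 1$ be two fixed constants. The decision problem $\langle I,T,\mathrm{sup},k,s\rangle$, restricted to inputs in which $I$ is a finite set of boolean attributes (with $|I|\ge k$), $T$ is a database on $I$, and $0<s\le 1$ is a rational with $\lceil s|T|\rceil=p$, is in $AC^0_2$.
   Context: An attribute $A$ (categorical or numeric) has a domain $\mathrm{dom}(A)$ containing a special null value $\epsilon$; $A$ is boolean if $\mathrm{dom}(A)=\{\epsilon,c(A)\}$ for a constant $c(A)$. A database $T$ on a finite attribute set $I$ is a relation with duplicates (a finite multiset of tuples) having attribute set $I$; $t[A]$ is the value of $A$ in tuple $t$. An atomic condition on a categorical attribute $A$ is $A=u$ or $A\neq u$ with $u\in \mathrm{dom}(A)\setminus\{\epsilon\}$; on a numeric attribute $A$ it is $A\in[l,u]$ or $A\notin[l,u]$ with numeric values $l\le u$. A tuple $t$ satisfies an atomic condition on $A$ iff $t[A]\neq\epsilon$ and $t[A]$ fulfils the stated relation (so a null value satisfies no condition). A condition is a conjunction $C=C_1\wedge\dots\wedge C_n$ of atomic conditions on distinct attributes; its size is $|C|=n$; $t$ satisfies $C$ iff it satisfies every $C_i$; $T_C$ is the (multi)set of tuples of $T$ satisfying $C$, with $|T_C|$ counted with duplicates. An association rule on $I$ is $B\Rightarrow H$ with $B,H$ conditions on attribute sets $I_B,I_H$ with $\emptyset\subset I_B,I_H\subset I$ and $I_B\cap I_H=\emptyset$; its size is $|B\Rightarrow H|=|B|+|H|$. It is trivial (w.r.t. $T$) if $B\wedge H$ contains at least one atomic condition $C_a$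 with $T_{C_a}=T$. The support is $\mathrm{sup}(B\Rightarrow H,T)=|T_{B\wedge H}|/|T|$. The problem $\langle I,T,\rho,k,s\rangle$ for an index $\rho$ asks: is there a non-trivial association rule $R$ on $I$ with $|R|\ge k$ and $\rho(R,T)\ge s$? The circuit for inputs with $m=|T|$ tuples $t_1,\dots,t_m$ and $n=|I|$ attributes $A_1,\dots,A_n$ receives the $m\times n$ boolean matrix $(x_{i,j})$ with $x_{i,j}=1$ if $t_i[A_j]=c(A_j)$ and $x_{i,j}=0$ if $t_i[A_j]=\epsilon$. $AC^0$ is the class of decision problems solved by (logspace-)uniform families of circuits of polynomial size and constant depth with AND, OR and NOT gates of unbounded fan-in; $AC^0_2$ denotes the restriction to circuits of depth $2$ (inputs may be used negated). -}

module Defs where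

open import Data.Bool.Base using (Bool; true; false; if_then_else_; not; T)
open import Data.Bool.ListAction using (and; or)
open import Data.Fin.Base using (Fin; toℕ)
open import Data.Fin.Subset using (Subset; ⊥; ⊤; ⁅_⁆; ⋃; _∩_; _⊂_; Empty)
open import Data.Integer.Base using (+_)
open import Data.List.Base
  using (List; []; _∷_; _++_; [_]; length; map; filter; concatMap; foldr; replicate; lookup)
open import Data.List.Relation.Binary.Permutation.Propositional using (_↭_)
open import Data.List.Relation.Unary.All using (All; all?)
import Data.List.Relation.Unary.Any as List
open import Data.List.Relation.Unary.Unique.Propositional using (Unique)
open import Data.Maybe.Base using (Maybe; nothing; just; is-just)
import Data.Maybe.Base as Maybe using (map)
import Data.Maybe.Relation.Unary.Any as Maybe using (Any; dec)
open import Data.Nat.Base using (ℕ; suc; _+_; _*_; _^_; _≤_; _⊔_; NonZero)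
open import Data.Nat.Binary.Base using (ℕᵇ; zero; 2[1+_]; 1+[2_]; fromℕ)
open import Data.Nat.Logarithm using (⌈log₂_⌉)
open import Data.Product.Base using (∃; _×_; _,_; proj₁; proj₂)
open import Data.Rational.Base as ℚ using (ℚ; 0ℚ; 1ℚ; _/_; ceiling)
import Data.Rational.Properties as ℚ
open import Data.Sum.Base using (_⊎_)
open import Data.Vec.Base as Vec using (Vec; []; _∷_)
open import Function.Bundles using (_↔_; _⇔_)
open import Relation.Binary.Construct.Closure.ReflexiveTransitive using (Star)
open import Relation.Binary.Definitions using (DecidableEquality)
open import Relation.Binary.PropositionalEquality.Core using (_≡_; _≢_)
open import Relation.Nullary using (¬_; Dec; ¬?; _×-dec_)

------------------------------------------------------------------------
-- Databases and association rules

-- The arguments give the non-null values: a type with decidable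
-- equality, or a subset of ℚ.

data Attribute : Set₁ where
  categorical : (V : Set) → DecidableEquality V → Attribute
  numeric     : (ℚ → Bool) → Attribute

Value : Attribute → Set
Value (categorical V _) = V
Value (numeric P)       = ∃ λ q → T (P q)

-- The null value ε is nothing.

Dom : Attribute → Set
Dom A = Maybe (Value A)

IsBoolean : Attribute → Set
IsBoolean A = ∃ λ (c : Value A) → ∀ (d : Dom A) → d ≡ nothing ⊎ d ≡ just c

Schema : ℕ → Set₁
Schema n = Fin n → Attribute

Tuple : ∀ {n} → Schema n → Set
Tuple I = ∀ j → Dom (I j)

-- A multiset of tuples is given by a listing, which is also the order in
-- which a circuit receives them; multiset equality is _↭_.

Database : ∀ {n} → Schema n → Set
Database I = List (Tuple I)

data Equation (V : Set) : Set where
  is isn't : V → Equation V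

data Interval : Set where
  inside outside : (l u : ℚ) → l ℚ.≤ u → Interval

Atomic : Attribute → Set
Atomic (categorical V _) = Equation V
Atomic (numeric _)       = Interval

Fulfils : ∀ A → Atomic A → Value A → Set
Fulfils (categorical _ _) (is u)          v       = v ≡ u
Fulfils (categorical _ _) (isn't u)       v       = v ≢ u
Fulfils (numeric _)       (inside l u _)  (q , _) = l ℚ.≤ q × q ℚ.≤ u
Fulfils (numeric _)       (outside l u _) (q , _) = ¬ (l ℚ.≤ q × q ℚ.≤ u)

fulfils? : ∀ A (a : Atomic A) (v : Value A) → Dec (Fulfils A a v)
fulfils? (categorical _ _≟_) (is u)          v       = v ≟ u
fulfils? (categorical _ _≟_) (isn't u)       v       = ¬? (v ≟ u)
fulfils? (numeric _)         (inside l u _)  (q , _) = (l ℚ.≤? q) ×-dec (q ℚ.≤? u)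
fulfils? (numeric _)         (outside l u _) (q , _) = ¬? ((l ℚ.≤? q) ×-dec (q ℚ.≤? u))

module _ {n} (I : Schema n) where

  AtomicCondition : Set
  AtomicCondition = ∃ λ j → Atomic (I j)

  Conjunction : Set
  Conjunction = List AtomicCondition

  record Condition : Set where
    field
      conjuncts : Conjunction
      distinct  : Unique (map proj₁ conjuncts)

    attributes : Subset n
    attributes = ⋃ (map (λ a → ⁅ proj₁ a ⁆) conjuncts)

  record Rule : Set where
    field
      body head : Condition

    open Condition body public using () renaming (attributes to I-body)
    open Condition head public using () renaming (attributes to I-head)

    field
      ∅⊂I-body : ⊥ ⊂ I-body
      I-body⊂I : I-body ⊂ ⊤
      ∅⊂I-head : ⊥ ⊂ I-head
      I-head⊂I : I-head ⊂ ⊤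
      disjoint : Empty (I-body ∩ I-head)

    body∧head : Conjunction
    body∧head = Condition.conjuncts body ++ Condition.conjuncts head

module _ {n} {I : Schema n} where

  ruleSize : Rule I → ℕ
  ruleSize R = length (conjuncts body) + length (conjuncts head)
    where open Rule R; open Condition

  -- Maybe.Any fails on the null value.

  _⊨_ : Tuple I → AtomicCondition I → Set
  t ⊨ (j , a) = Maybe.Any (Fulfils (I j) a) (t j)

  _⊨?_ : ∀ t a → Dec (t ⊨ a)
  t ⊨? (j , a) = Maybe.dec (fulfils? (I j) a) (t j)

  select : Conjunction I → Database I → Database I
  select C = filter (λ t → all? (t ⊨?_) C)

  Trivial : Rule I → Database I → Set
  Trivial R D = List.Any (λ a → select [ a ] D ↭ D) (Rule.body∧head R)

Index : Set₁
Index = ∀ {n} {I : Schema n} → Rule I → (D : Database I) → .{{NonZero (length D)}} → ℚ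

sup : Index
sup R D = + length (select (Rule.body∧head R) D) / length D

⟨_,_,_,_,_⟩ : ∀ {n} (I : Schema n) (D : Database I) .{{_ : NonZero (length D)}} →
              Index → ℕ → ℚ → Set
⟨ I , D , ρ , k , s ⟩ = ∃ λ (R : Rule I) → ¬ Trivial R D × k ≤ ruleSize R × s ℚ.≤ ρ R D

------------------------------------------------------------------------
-- Boolean circuits of unbounded fan-in

-- X indexes the inputs.  A literal (true , x) is the input x and
-- (false , x) its negation.  Gates are numbered backwards: among the g
-- gates available to a wire, number 0 is the latest one.

data Wire (X : Set) (g : ℕ) : Set where
  literal : Bool → X → Wire X g
  gate    : Fin g → Wire X g

data Gate (X : Set) (g : ℕ) : Set where
  AND OR : List (Wire X g) → Gate X g
  NOT    : Wire X g → Gate X g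

data Gates (X : Set) : ℕ → Set where
  []  : Gates X 0
  _▷_ : ∀ {g} → Gates X g → Gate X g → Gates X (suc g)

record Circuit (X : Set) : Set where
  constructor circuit
  field
    {count} : ℕ
    gates   : Gates X count
    output  : Wire X count

module Interpretation {X A : Set} (lit : Bool → X → A)
                      (conj disj : List A → A) (neg : A → A) where

  onWire : ∀ {g} → Vec A g → Wire X g → A
  onWire ρ (literal b x) = lit b x
  onWire ρ (gate i)      = Vec.lookup ρ i

  onGate : ∀ {g} → Vec A g → Gate X g → A
  onGate ρ (AND ws) = conj (map (onWire ρ) ws)
  onGate ρ (OR ws)  = disj (map (onWire ρ) ws)
  onGate ρ (NOT w)  = neg (onWire ρ w)

  onGates : ∀ {g} → Gates X g → Vec A g
  onGates []       = []
  onGates (gs ▷ h) = onGate (onGates gs) h ∷ onGates gs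

  onCircuit : Circuit X → A
  onCircuit (circuit gs w) = onWire (onGates gs) w

eval : ∀ {X} → Circuit X → (X → Bool) → Bool
eval C x = onCircuit C
  where open Interpretation (λ b i → if b then x i else not (x i)) and or not

-- Literals, negated or not, have depth 0.

depth : ∀ {X} → Circuit X → ℕ
depth = onCircuit
  where
  deepest : List ℕ → ℕ
  deepest = foldr _⊔_ 0
  open Interpretation (λ _ _ → 0) (λ ds → suc (deepest ds)) (λ ds → suc (deepest ds)) suc

fanIn : ∀ {X g} → Gate X g → ℕ
fanIn (AND ws) = length ws
fanIn (OR ws)  = length ws
fanIn (NOT _)  = 1

-- Both gates and the wires entering them are counted.

size : ∀ {X} → Circuit X → ℕ
size {X} (circuit gs _) = go gs
  where
  go : ∀ {g} → Gates X g → ℕ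
  go []       = 0
  go (gs ▷ h) = go gs + suc (fanIn h)

-- Descriptions of circuits on a matrix of inputs.  Numbers are written
-- in bijective base 2 (as in ℕᵇ), least significant digit first.

data Letter : Set where
  one two stop                     : Letter
  positive negative wire           : Letter
  and-gate or-gate not-gate output : Letter

digits : ℕᵇ → List Letter
digits zero     = []
digits 1+[2 b ] = one ∷ digits b
digits 2[1+ b ] = two ∷ digits b

describeℕ : ℕ → List Letter
describeℕ i = digits (fromℕ i) ++ [ stop ]

Matrix : ℕ → ℕ → Set
Matrix m n = Fin m × Fin n

module _ {m n : ℕ} where

  describeWire : ∀ {g} → Wire (Matrix m n) g → List Letter
  describeWire (literal b (i , j)) =
    (if b then positive else negative) ∷ describeℕ (toℕ i) ++ describeℕ (toℕ j)
  describeWire (gate i) = wire ∷ describeℕ (toℕ i)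

  describeGate : ∀ {g} → Gate (Matrix m n) g → List Letter
  describeGate (AND ws) = and-gate ∷ concatMap describeWire ws
  describeGate (OR ws)  = or-gate ∷ concatMap describeWire ws
  describeGate (NOT w)  = not-gate ∷ describeWire w

  describeGates : ∀ {g} → Gates (Matrix m n) g → List Letter
  describeGates []       = []
  describeGates (gs ▷ h) = describeGates gs ++ describeGate h

  describe : Circuit (Matrix m n) → List Letter
  describe (circuit gs w) = describeGates gs ++ output ∷ describeWire w

------------------------------------------------------------------------
-- Turing machines with a two-way read-only input tape, finitely many
-- work tapes, and a write-only output tape

data Move : Set where
  left stay right : Move

-- The part of the tape left of the head is listed from right to left.

record Tape (A : Set) : Set where
  constructor tape
  field
    before : List A
    here   : A
    after  : List A

  cells : ℕ
  cells = length before + suc (length after)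

-- The input head does not leave the input tape, whereas a work tape is
-- extended by a blank cell whenever its head leaves the cells visited so
-- far.

moveInput : ∀ {A} → Move → Tape A → Tape A
moveInput left  (tape (y ∷ l) x r)  = tape l y (x ∷ r)
moveInput right (tape l x (y ∷ r))  = tape (x ∷ l) y r
moveInput _     t                   = t

moveWork : ∀ {A} → A → Move → Tape A → Tape A
moveWork _     left  (tape (y ∷ l) x r) = tape l y (x ∷ r)
moveWork blank left  (tape [] x r)      = tape [] blank (x ∷ r)
moveWork _     stay  t                  = t
moveWork _     right (tape l x (y ∷ r)) = tape (x ∷ l) y r
moveWork blank right (tape l x [])      = tape (x ∷ l) blank []

write : ∀ {A} → A → Tape A → Tape A
write a (tape l _ r) = tape l a r

Finite : Set → Set
Finite A = ∃ λ n → A ↔ Fin n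

-- Q and Γ are the states and the work tape symbols; Σ and Ω are the input
-- and output alphabets.

record Action (Q Γ Ω : Set) (tapes : ℕ) : Set where
  constructor action
  field
    next      : Q
    inputMove : Move
    work      : Vec (Γ × Move) tapes
    emit      : List Ω

record Transducer (Σ Ω : Set) : Set₁ where
  field
    State Symbol  : Set
    finiteStates  : Finite State
    finiteSymbols : Finite Symbol
    start         : State
    blank         : Symbol
    tapes         : ℕ

    -- The argument nothing is the marker at either end of the input tape;
    -- the machine halts when δ returns nothing.

    δ : State → Maybe Σ → Vec Symbol tapes → Maybe (Action State Symbol Ω tapes)

module _ {Σ Ω : Set} (M : Transducer Σ Ω) where

  open Transducer M

  record Configuration : Set where
    constructor configuration
    field
      state   : State
      input   : Tape (Maybe Σ)
      work    : Vec (Tape Symbol) tapes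
      emitted : List Ω

    -- Visited cells are never discarded, so this is the number of work
    -- tape cells used by the whole computation leading here.

    space : ℕ
    space = Vec.sum (Vec.map Tape.cells work)

  initial : List Σ → Configuration
  initial w = configuration start
    (tape [] nothing (map just w ++ [ nothing ]))
    (Vec.replicate tapes (tape [] blank [])) []

  perform : Configuration → Action State Symbol Ω tapes → Configuration
  perform (configuration _ input work emitted) (action q move acts out) =
    configuration q (moveInput move input)
      (Vec.zipWith (λ (s , v) t → moveWork blank v (write s t)) acts work)
      (emitted ++ out)

  step : Configuration → Maybe Configuration
  step c = Maybe.map (perform c)
             (δ state (Tape.here input) (Vec.map Tape.here work))
    where open Configuration c

  _⟶*_ : Configuration → Configuration → Set
  _⟶*_ = Star (λ c d → step c ≡ just d)

  Transduces : List Σ → List Ω → ℕ → Set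
  Transduces w v S = ∃ λ c → initial w ⟶* c × step c ≡ nothing ×
    Configuration.emitted c ≡ v × Configuration.space c ≤ S

------------------------------------------------------------------------
-- AC⁰ with bounded depth

Family : Set
Family = ∀ m n → Circuit (Matrix m n)

unary : ℕ → ℕ → List Bool
unary m n = replicate m true ++ false ∷ replicate n true

LogspaceUniform : Family → Set₁
LogspaceUniform C = ∃ λ (M : Transducer Bool Letter) → ∃ λ c → ∀ m n →
  Transduces M (unary m n) (describe (C m n))
    (c * ⌈log₂ length (unary m n) ⌉ + c)

PolynomialSize : Family → Set
PolynomialSize C = ∃ λ c → ∃ λ d → ∀ m n → size (C m n) ≤ c * (m * n) ^ d + c

-- A decision problem on (a restricted set of) instances that are
-- presented to circuits as Boolean matrices.

record Problem : Set₂ where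
  field
    Instance  : Set₁
    rows cols : Instance → ℕ
    matrix    : ∀ x → Matrix (rows x) (cols x) → Bool
    Yes       : Instance → Set

Decides : Family → Problem → Set₁
Decides C P = ∀ x → eval (C (rows x) (cols x)) (matrix x) ≡ true ⇔ Yes x
  where open Problem P

record AC⁰[_] (d : ℕ) (P : Problem) : Set₁ where
  field
    family         : Family
    boundedDepth   : ∀ m n → depth (family m n) ≤ d
    polynomialSize : PolynomialSize family
    uniform        : LogspaceUniform family
    decides        : Decides family P

------------------------------------------------------------------------
-- The restricted problem

record Input (k p : ℕ) : Set₁ where
  field
    n         : ℕ
    I         : Schema n
    isBoolean : ∀ j → IsBoolean (I j)
    k≤n       : k ≤ n
    D         : Database I
    s         : ℚ
    0<s       : 0ℚ ℚ.< s
    s≤1       : s ℚ.≤ 1ℚ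
    threshold : ceiling (s ℚ.* (+ length D / 1)) ≡ + p
    -- Follows from threshold when p is positive.
    .{{nonempty}} : NonZero (length D)

-- The only non-null value of a Boolean attribute A is c(A), so an entry
-- of the matrix is 1 exactly when the corresponding value is c(A).

supportProblem : ℕ → ℕ → Problem
supportProblem k p = record
  { Instance = Input k p
  ; rows     = λ x → length (D x)
  ; cols     = n
  ; matrix   = λ x (i , j) → is-just (lookup (D x) i j)
  ; Yes      = λ x → ⟨ I x , D x , sup , k , s x ⟩
  }
  where open Input

{-# OPTIONS --safe #-}

-- Since p ≥ 1, the conditions of a rule that reaches the threshold are all
-- of the form "A is not null", and a rule can be shrunk as long as it keeps
-- two conditions.  With q = max(k, 2), the answer is therefore yes iff
-- there are q columns and p rows such that the rows have no null value in
-- the columns and every column has a null value in some row.  Choosing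
-- these q further rows along with the p rows and the q columns gives a
-- disjunction of O(m^(p+q) n^q) conjunctions of pq + q literals each.
--
-- A machine lists the conjunctions by p + 2q nested loops, whose counters
-- take logarithmic space.  Distinct rows (and columns) are obtained without
-- any test by letting each loop counter run below that of the enclosing
-- loop.  The machine is written in a small language of while programs,
-- where each tape stores a number in the notation of the description.

module Submission where

open import Defs
open import Data.Bool.Base using (Bool; true; false; if_then_else_; not)
open import Data.Bool.ListAction using (and; or)
import Data.Bool.Properties as Bool
open import Data.Empty using (⊥-elim)
open import Data.Fin.Base as Fin
  using (Fin; zero; suc; toℕ; fromℕ<; opposite; splitAt; _↑ˡ_; _↑ʳ_)
import Data.Fin.Properties as Fin
import Data.Fin.Subset as Subset
import Data.Fin.Subset.Properties as Subset
open import Data.Integer.Base as ℤ using (ℤ; -[1+_])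
import Data.Integer.DivMod as ℤ
import Data.Integer.Properties as ℤ
open import Data.List.Base as List
  using (List; []; _∷_; _++_; _ʳ++_; [_]; length; concat; concatMap; replicate; reverse;
         foldr; filter; applyUpTo; upTo; allFin)
import Data.List.Properties as List
open import Data.List.Membership.Propositional using (_∈_; find; lose)
open import Data.List.Membership.Propositional.Properties
  using (∈-map⁺; ∈-map⁻; ∈-concatMap⁺; ∈-concatMap⁻; ∈-lookup; ∈-tabulate⁺; ∈-filter⁺; ∈-allFin)
open import Data.List.Relation.Binary.Permutation.Propositional using (_↭_; ↭-reflexive)
open import Data.List.Relation.Binary.Permutation.Propositional.Properties using (↭-length)
open import Data.List.Relation.Unary.All as All using (All; []; _∷_; all?)
import Data.List.Relation.Unary.All.Properties as All
open import Data.List.Relation.Unary.AllPairs as AllPairs using (AllPairs; []; _∷_)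
import Data.List.Relation.Unary.AllPairs.Properties as AllPairs
open import Data.List.Relation.Unary.Any as Any using (Any; here; there)
import Data.List.Relation.Unary.Any.Properties as Any
open import Data.List.Relation.Unary.Unique.Propositional using (Unique)
import Data.List.Relation.Unary.Unique.Propositional.Properties as Unique
open import Data.Maybe.Base as Maybe using (Maybe; nothing; just; maybe; is-just; _>>=_)
import Data.Maybe.Properties as Maybe
import Data.Maybe.Relation.Unary.Any as Maybe using (Any; just)
open import Data.Nat.Base
  using (ℕ; zero; suc; pred; _+_; _*_; _∸_; _^_; _⊔_; _≤_; _<_; ⌊_/2⌋; ⌈_/2⌉; NonZero; z≤n; s≤s)
open import Data.Nat.Binary.Base as ℕᵇ using (ℕᵇ; zero; 2[1+_]; 1+[2_]; fromℕ) renaming (suc to sucᵇ)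
import Data.Nat.Binary.Properties as ℕᵇ
open import Data.Nat.Induction using (<-rec)
open import Data.Nat.Logarithm using (⌈log₂_⌉; ⌈log₂⌈n/2⌉⌉≡⌈log₂n⌉∸1; ⌈log₂⌉-mono-≤)
import Data.Nat.Properties as ℕ
open import Data.Product.Base as Product using (∃; _×_; _,_; proj₁; proj₂)
open import Data.Rational.Base as ℚ using (ℚ; mkℚ; _/_; ceiling)
import Data.Rational.Properties as ℚ
open import Data.Rational.Unnormalised.Base as ℚᵘ using (mkℚᵘ; *≤*; *≡*; _≃_)
import Data.Rational.Unnormalised.Properties as ℚᵘ
open import Data.Sum.Base using (_⊎_; inj₁; inj₂)
open import Data.Sum.Function.Propositional using (_⊎-↔_)
open import Data.Unit.Base using (⊤; tt)
open import Data.Vec.Base as Vec using (Vec; []; _∷_; lookup; toList; tabulate; _[_]≔_)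
import Data.Vec.Properties as Vec
open import Data.Vec.Relation.Unary.All as AllV using ([]; _∷_) renaming (All to AllV)
import Data.Vec.Relation.Unary.All.Properties as AllV
open import Data.Vec.Relation.Unary.AllPairs.Core using ([]; _∷_)
open import Data.Vec.Relation.Unary.Unique.Propositional using () renaming (Unique to UniqueV)
import Data.Vec.Relation.Unary.Unique.Propositional.Properties as UniqueV
open import Function.Base using (_∘_; id)
open import Function.Bundles using (Inverse; mk↔ₛ′; mk⇔)
open import Function.Construct.Composition using (_↔-∘_)
open import Function.Construct.Symmetry using (↔-sym)
open import Relation.Binary.Construct.Closure.ReflexiveTransitive using (ε; _◅_; _◅◅_; gmap)
open import Relation.Binary.Definitions using (DecidableEquality)
open import Relation.Binary.PropositionalEquality hiding ([_])
open import Relation.Nullary using (¬_; Dec; yes; no; does)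
open import Relation.Nullary.Decidable using (dec-true; dec-false)
open import Relation.Unary using (Decidable)

-- While programs and their compilation to transducers

-- The maximum with 2 comes from the body and the head of a rule, each of which needs a condition. A
-- condition that holds in one row holds in every row that is not null there, because the non-null
-- values of a Boolean attribute coincide. Hence a single supporting row, available as p ≥ 1,
-- settles all conditions of a rule at once, whatever their syntactic form. The rational s enters
-- only through its ceiling: the support is at least s iff at least p rows satisfy the rule.
--
-- The OR gate has to name every conjunction. The machine counts the conjunctions while printing
-- them, and this count bounds one more loop that prints the wires. As wires are numbered backwards
-- from the latest gate, they are 0, 1, 2 and so on up to the count.
--
-- Space is measured by the cells ever visited, not by the numbers currently stored. The
-- specification of every tape operation therefore also tracks the blank cells that follow the
-- digits, and shows that a tape grows only if its number does or if one blank is needed to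
-- recognise the end of the number.

finite-⊤ : Finite ⊤
finite-⊤ = 1 , ↔-sym Fin.1↔⊤

finite-⊎ : ∀ {A B} → Finite A → Finite B → Finite (A ⊎ B)
finite-⊎ (m , f) (n , g) = m + n , ↔-sym Fin.+↔⊎ ↔-∘ (f ⊎-↔ g)

finite-Maybe : ∀ {A} → Finite A → Finite (Maybe A)
finite-Maybe {A} (n , f) = suc n , mk↔ₛ′ to from to-from from-to
  where
  open Inverse f using () renaming
    (to to to₀; from to from₀; strictlyInverseˡ to invˡ; strictlyInverseʳ to invʳ)
  to : Maybe A → Fin (suc n)
  to = maybe (suc ∘ to₀) zero
  from : Fin (suc n) → Maybe A
  from zero    = nothing
  from (suc i) = just (from₀ i)
  to-from : ∀ i → to (from i) ≡ i
  to-from zero    = refl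
  to-from (suc i) = cong suc (invˡ i)
  from-to : ∀ a → from (to a) ≡ a
  from-to nothing  = refl
  from-to (just a) = cong just (invʳ a)

finite-Bool : Finite Bool
finite-Bool = 2 , ↔-sym Fin.2↔Bool

-- A blank cell is nothing; the digits one and two of bijective base 2 are
-- false and true.

Symbol : Set
Symbol = Maybe Bool

Reading : ℕ → Set → Set
Reading R A = Maybe Bool → Vec Symbol R → A

data Program (R : ℕ) : Set where
  act   : Reading R (Action ⊤ Symbol Letter R) → Program R
  _⨾_   : Program R → Program R → Program R
  while : Reading R Bool → Program R → Program R

infixr 5 _⨾_

moveWrite : Symbol × Move → Tape Symbol → Tape Symbol
moveWrite (s , v) t = moveWork nothing v (write s t)

-- An `Action` writes on every tape, so leaving a tape alone means writing back the symbol just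
-- scanned.
zipWith-idle : ∀ {n} (ts : Vec (Tape Symbol) n) →
  Vec.zipWith moveWrite (Vec.map (_, stay) (Vec.map Tape.here ts)) ts ≡ ts
zipWith-idle []       = refl
zipWith-idle (t ∷ ts) = cong (t ∷_) (zipWith-idle ts)

module _ {R : ℕ} where

  -- A loop has one more state than its body: that of testing.

  Point : Program R → Set
  Point (act _)     = ⊤
  Point (P ⨾ Q)     = Point P ⊎ Point Q
  Point (while _ P) = Maybe (Point P)

  entry : ∀ P → Point P
  entry (act _)     = tt
  entry (P ⨾ Q)     = inj₁ (entry P)
  entry (while _ P) = nothing

  finite-Point : ∀ P → Finite (Point P)
  finite-Point (act _)     = finite-⊤
  finite-Point (P ⨾ Q)     = finite-⊎ (finite-Point P) (finite-Point Q)
  finite-Point (while _ P) = finite-Maybe (finite-Point P)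

  goto : ∀ {A B : Set} → (A → B) → Action A Symbol Letter R → Action B Symbol Letter R
  goto f (action q v w o) = action (f q) v w o

  idle : ∀ {A : Set} → A → Vec Symbol R → Action A Symbol Letter R
  idle q v = action q stay (Vec.map (_, stay) v) []

  -- The end of a program is nothing.

  continue : ∀ P Q → Maybe (Point P) → Maybe (Point (P ⨾ Q))
  continue P Q = just ∘ maybe inj₁ (inj₂ (entry Q))

  transition : ∀ P → Point P → Reading R (Action (Maybe (Point P)) Symbol Letter R)
  transition (act f)     _        i v = goto (λ _ → nothing) (f i v)
  transition (P ⨾ Q)     (inj₁ s) i v = goto (continue P Q) (transition P s i v)
  transition (P ⨾ Q)     (inj₂ s) i v = goto (Maybe.map inj₂) (transition Q s i v)
  transition (while b P) nothing  i v = idle (if b i v then just (just (entry P)) else nothing) v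
  -- `goto just` sends the end `nothing` of the body to `just nothing`, the testing state; this
  -- closes the loop.
  transition (while b P) (just s) i v = goto just (transition P s i v)

  machine : Program R → Transducer Bool Letter
  machine P = record
    { State         = Maybe (Point P)
    ; Symbol        = Symbol
    ; finiteStates  = finite-Maybe (finite-Point P)
    ; finiteSymbols = finite-Maybe finite-Bool
    ; start         = just (entry P)
    ; blank         = nothing
    ; tapes         = R
    ; δ             = λ s i v → Maybe.map (λ s → transition P s i v) s
    }

  record Memory : Set where
    constructor memory
    field
      input   : Tape (Maybe Bool)
      work    : Vec (Tape Symbol) R
      emitted : List Letter

  _at_ : ∀ {P} → Memory → Maybe (Point P) → Configuration (machine P)
  memory i w o at s = configuration s i w o

  goto-configuration : ∀ {P Q} → (Maybe (Point P) → Maybe (Point Q)) →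
    Configuration (machine P) → Configuration (machine Q)
  goto-configuration f (configuration s i w o) = configuration (f s) i w o

  infix 3 _⊢_⇝_

  record _⊢_⇝_ (P : Program R) (μ ν : Memory) : Set where
    constructor run
    field
      steps : _⟶*_ (machine P) (μ at just (entry P)) (ν at nothing)

  -- Only the states `just s` are constrained. At `nothing` the machine of `P` halts, so no step
  -- starts there, and `f nothing` is free to be the entry of whatever comes next.
  embed : ∀ {P Q} (f : Maybe (Point P) → Maybe (Point Q)) →
    (∀ s i v → Transducer.δ (machine Q) (f (just s)) i v ≡ just (goto f (transition P s i v))) →
    ∀ {c d} → _⟶*_ (machine P) c d →
    _⟶*_ (machine Q) (goto-configuration f c) (goto-configuration f d)
  embed {P} {Q} f δ-f = gmap (goto-configuration f) (λ {c} → embed-step c)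
    where
    embed-step : ∀ c {d} → step (machine P) c ≡ just d →
      step (machine Q) (goto-configuration f c) ≡ just (goto-configuration f d)
    embed-step (configuration (just s) i w o) refl
      rewrite δ-f s (Tape.here i) (Vec.map Tape.here w) = refl

  ⇝-⨾ : ∀ {P Q μ ν ξ} → P ⊢ μ ⇝ ν → Q ⊢ ν ⇝ ξ → (P ⨾ Q) ⊢ μ ⇝ ξ
  ⇝-⨾ {P} {Q} (run p) (run q) = run (
    embed (continue P Q) (λ _ _ _ → refl) p ◅◅ embed (Maybe.map inj₂) (λ _ _ _ → refl) q)

  holds : Reading R Bool → Memory → Bool
  holds b (memory i w _) = b (Tape.here i) (Vec.map Tape.here w)

  ⟶-test : ∀ b P μ → step (machine (while b P)) (μ at just nothing) ≡
    just (μ at (if holds b μ then just (just (entry P)) else nothing))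
  ⟶-test b P μ@(memory i w o) = cong₂ (λ w o → just (configuration q i w o))
    (zipWith-idle w) (List.++-identityʳ o)
    where
    q : Maybe (Point (while b P))
    q = if holds b μ then just (just (entry P)) else nothing

  ⇝-while-false : ∀ {b P μ} → holds b μ ≡ false → while b P ⊢ μ ⇝ μ
  ⇝-while-false {b} {P} {μ} h = run (test ◅ ε)
    where
    test : step (machine (while b P)) (μ at just nothing) ≡ just (μ at nothing)
    test with ⟶-test b P μ
    ... | eq rewrite h = eq

  ⇝-while-true : ∀ {b P μ ν ξ} → holds b μ ≡ true →
    P ⊢ μ ⇝ ν → while b P ⊢ ν ⇝ ξ → while b P ⊢ μ ⇝ ξ
  ⇝-while-true {b} {P} {μ} h (run p) (run w) = run (test ◅ embed just (λ _ _ _ → refl) p ◅◅ w)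
    where
    test : step (machine (while b P)) (μ at just nothing) ≡ just (μ at just (just (entry P)))
    test with ⟶-test b P μ
    ... | eq rewrite h = eq

  execute : Reading R (Action ⊤ Symbol Letter R) → Memory → Memory
  execute f (memory i w o) = memory (moveInput inputMove i) (Vec.zipWith moveWrite work w) (o ++ emit)
    where open Action (f (Tape.here i) (Vec.map Tape.here w))

  ⇝-act : ∀ {f μ} → act f ⊢ μ ⇝ execute f μ
  ⇝-act = run (refl ◅ ε)

-- Operations on one tape

bit : Bool → Letter
bit false = one
bit true  = two

bits : ℕᵇ → List Bool
bits zero     = []
bits 1+[2 x ] = false ∷ bits x
bits 2[1+ x ] = true ∷ bits x

digits-bits : ∀ x → concatMap (λ b → [ bit b ]) (bits x) ≡ digits x
digits-bits zero     = refl
digits-bits 1+[2 x ] = cong (one ∷_) (digits-bits x)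
digits-bits 2[1+ x ] = cong (two ∷_) (digits-bits x)

bits-injective : ∀ {x y} → bits x ≡ bits y → x ≡ y
bits-injective {zero}     {zero}     _  = refl
bits-injective {1+[2 x ]} {1+[2 y ]} eq = cong 1+[2_] (bits-injective (List.∷-injectiveʳ eq))
bits-injective {2[1+ x ]} {2[1+ y ]} eq = cong 2[1+_] (bits-injective (List.∷-injectiveʳ eq))

fromℕ-suc : ∀ v → fromℕ (suc v) ≡ sucᵇ (fromℕ v)
fromℕ-suc v = trans (ℕᵇ.fromℕ≡fromℕ' (suc v)) (cong sucᵇ (sym (ℕᵇ.fromℕ≡fromℕ' v)))

2^length-bits : ∀ x → 2 ^ length (bits x) ≤ suc (ℕᵇ.toℕ x)
2^length-bits zero     = s≤s z≤n
2^length-bits 1+[2 x ] = begin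
  2 * 2 ^ length (bits x) ≤⟨ ℕ.*-monoʳ-≤ 2 (2^length-bits x) ⟩
  2 * suc (ℕᵇ.toℕ x)   ≡⟨ ℕ.*-suc 2 (ℕᵇ.toℕ x) ⟩
  suc (ℕᵇ.toℕ 1+[2 x ])   ∎
  where open ℕ.≤-Reasoning
2^length-bits 2[1+ x ] = begin
  2 * 2 ^ length (bits x) ≤⟨ ℕ.*-monoʳ-≤ 2 (2^length-bits x) ⟩
  2 * suc (ℕᵇ.toℕ x)   ≤⟨ ℕ.n≤1+n _ ⟩
  suc (ℕᵇ.toℕ 2[1+ x ])   ∎
  where open ℕ.≤-Reasoning

length-bits-≤ : ∀ {v w} → v < 2 ^ w → length (bits (fromℕ v)) ≤ w
length-bits-≤ {v} {w} v<2^w = ℕ.≮⇒≥ λ w<l → ℕ.<-irrefl refl (begin-strict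
  2 ^ w                           <⟨ ℕ.^-monoʳ-< 2 (s≤s (s≤s z≤n)) w<l ⟩
  2 ^ length (bits (fromℕ v))     ≤⟨ 2^length-bits (fromℕ v) ⟩
  suc (ℕᵇ.toℕ (fromℕ v))             ≡⟨ cong suc (ℕᵇ.toℕ-fromℕ v) ⟩
  suc v                           ≤⟨ v<2^w ⟩
  2 ^ w                           ∎)
  where open ℕ.≤-Reasoning

-- The `z` blanks are cells visited earlier; they count towards the space used.
pad : List Bool → ℕ → List Symbol
pad bs z = List.map just bs ++ replicate z nothing

-- The blank cell left of the number is where a return pass stops. An initial tape is `home [] 0`.
home : List Bool → ℕ → Tape Symbol
home bs z = tape [] nothing (pad bs z)

-- For an empty list, `nothing` is the blank cell by which `moveWork` extends a tape when the head
-- leaves the visited cells.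
first : List Symbol → Symbol
first []      = nothing
first (c ∷ _) = c

rest : List Symbol → List Symbol
rest []       = []
rest (_ ∷ cs) = cs

-- The head is on the cell after the digits l, which are listed from right
-- to left.

past : List Bool → List Symbol → Tape Symbol
past l cs = tape (List.map just l ++ [ nothing ]) (first cs) (rest cs)

-- The same, with the head on the last digit.

upon : List Bool → List Symbol → Tape Symbol
upon []      cs = tape [] nothing cs
upon (b ∷ l) cs = tape (List.map just l ++ [ nothing ]) (just b) cs

move-right : ∀ l b cs → moveWrite (just b , right) (past l cs) ≡ past (b ∷ l) (rest cs)
move-right l b []           = refl
move-right l b (_ ∷ [])     = refl
move-right l b (_ ∷ _ ∷ cs) = refl

leave-home : ∀ bs z → moveWrite (nothing , right) (home bs z) ≡ past [] (pad bs z)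
leave-home bs z with pad bs z
... | []     = refl
... | _ ∷ cs = refl

move-left : ∀ l c cs → moveWrite (c , left) (past l cs) ≡ upon l (c ∷ rest cs)
move-left []      c cs = refl
move-left (b ∷ l) c cs = refl

move-left-upon : ∀ b l c cs → moveWrite (c , left) (upon (b ∷ l) cs) ≡ upon l (c ∷ cs)
move-left-upon b []      c cs = refl
move-left-upon b (_ ∷ l) c cs = refl

-- A forward pass stacks the digits in reverse on the left, and the return pass unstacks them while
-- applying `h`; the original order results.
map-ʳ++ : ∀ (h : Bool → Symbol) ds l cs →
  List.map h (ds ʳ++ l) ʳ++ cs ≡ List.map h l ʳ++ (List.map h ds ++ cs)
map-ʳ++ h []       l cs = refl
map-ʳ++ h (b ∷ ds) l cs = map-ʳ++ h ds (b ∷ l) cs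

-- A head that has gone beyond the last visited cell has created a blank there. The maximum says
-- that the tape keeps its extent or else has a single blank after the digits.
first∷rest-pad : ∀ bs z → ∃ λ z′ → first (pad bs z) ∷ rest (pad bs z) ≡ pad bs z′ ×
  length bs + z′ ≤ (length bs + z) ⊔ suc (length bs)
first∷rest-pad (b ∷ bs) z       = z , refl , ℕ.m≤m⊔n _ (suc (length (b ∷ bs)))
first∷rest-pad []       0       = 1 , refl , s≤s z≤n
first∷rest-pad []       (suc z) = suc z , refl , ℕ.m≤m⊔n _ 1

zipWith-[]≔ : ∀ {A B C : Set} (f : A → B → C) {n} (as : Vec A n) (bs : Vec B n) r a →
  Vec.zipWith f (as [ r ]≔ a) bs ≡ Vec.zipWith f as bs [ r ]≔ f a (lookup bs r)
zipWith-[]≔ f (a ∷ as) (b ∷ bs) zero    _ = refl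
zipWith-[]≔ f (a ∷ as) (b ∷ bs) (suc r) x = cong (_ ∷_) (zipWith-[]≔ f as bs r x)

first-blank : ∀ z → first (pad [] z) ≡ nothing
first-blank 0       = refl
first-blank (suc _) = refl

blank∷rest : ∀ z → nothing ∷ rest (pad [] z) ≡ pad [] (suc (pred z))
blank∷rest 0       = refl
blank∷rest (suc z) = refl

map-nothing : ∀ ds z → List.map {A = Bool} (λ _ → nothing) ds ++ pad [] z ≡ pad [] (length ds + z)
map-nothing []       z = refl
map-nothing (_ ∷ ds) z = cong (nothing ∷_) (map-nothing ds z)

concatMap-[] : ∀ (ds : List Bool) → concatMap {B = Letter} (λ _ → []) ds ≡ []
concatMap-[] []       = refl
concatMap-[] (_ ∷ ds) = concatMap-[] ds

is-two : Symbol → Bool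
is-two (just true) = true
is-two _           = false

-- In bijective base 2, an increment turns the initial run of twos into ones (`carry`) and then
-- raises the next cell: a one becomes a two, a blank becomes a one. Since `carry` has passed the
-- twos, `just _` is a one here.
successor : Symbol → Symbol
successor nothing  = just false
successor (just _) = just true

silent : Symbol → List Letter
silent _ = []

module _ {R : ℕ} where

  ⇝-emitted : ∀ {P : Program R} {μ i w o o′} → o ≡ o′ → P ⊢ μ ⇝ memory i w o → P ⊢ μ ⇝ memory i w o′
  ⇝-emitted refl p = p

  opaque

    whileAt : Fin R → (Symbol → Bool) → Program R → Program R
    whileAt r c = while (λ _ v → c (lookup v r))

    on : Fin R → (Symbol → Symbol × Move) → (Symbol → List Letter) → Program R
    on r f g = act λ _ v → action tt stay
      (Vec.map (_, stay) v [ r ]≔ f (lookup v r)) (g (lookup v r))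

  infix 3 _∶_⊢_⇒_▹_

  -- Quantifying over the other tapes, the input and the earlier output builds the frame rule into
  -- the notion, so that an operation can be verified on its own tape alone.
  record _∶_⊢_⇒_▹_ (r : Fin R) (P : Program R) (t t′ : Tape Symbol) (o : List Letter) : Set where
    constructor local
    field
      globalise : ∀ i w o₀ → P ⊢ memory i (w [ r ]≔ t) o₀ ⇝ memory i (w [ r ]≔ t′) (o₀ ++ o)

  here-≔ : ∀ (w : Vec (Tape Symbol) R) r t →
    lookup (Vec.map Tape.here (w [ r ]≔ t)) r ≡ Tape.here t
  here-≔ w r t = trans (Vec.lookup-map r Tape.here (w [ r ]≔ t))
    (cong Tape.here (Vec.lookup∘updateAt r w))

  zipWith-on : ∀ (f : Symbol → Symbol × Move) w r t → let W = w [ r ]≔ t; v = Vec.map Tape.here W in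
    Vec.zipWith moveWrite (Vec.map (_, stay) v [ r ]≔ f (lookup v r)) W ≡
      w [ r ]≔ moveWrite (f (Tape.here t)) t
  zipWith-on f w r t = begin
    Vec.zipWith moveWrite (Vec.map (_, stay) v [ r ]≔ f (lookup v r)) W
      ≡⟨ zipWith-[]≔ moveWrite (Vec.map (_, stay) v) W r _ ⟩
    Vec.zipWith moveWrite (Vec.map (_, stay) v) W
      [ r ]≔ moveWrite (f (lookup v r)) (lookup W r)
      ≡⟨ cong₂ (_[ r ]≔_) (zipWith-idle W)
           (cong₂ (λ s → moveWrite (f s)) (here-≔ w r t) (Vec.lookup∘updateAt r w)) ⟩
    w [ r ]≔ t [ r ]≔ moveWrite (f (Tape.here t)) t
      ≡⟨ Vec.[]≔-idempotent w r ⟩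
    w [ r ]≔ moveWrite (f (Tape.here t)) t ∎
    where
    open ≡-Reasoning
    W = w [ r ]≔ t
    v = Vec.map Tape.here W

  opaque
    unfolding on

    ⇒-on : ∀ {r f g} t → r ∶ on r f g ⊢ t ⇒ moveWrite (f (Tape.here t)) t ▹ g (Tape.here t)
    ⇒-on {r} {f} {g} t = local λ i w o →
      subst (λ μ → on r f g ⊢ memory i (w [ r ]≔ t) o ⇝ μ)
        (cong₂ (memory i) (zipWith-on f w r t) (cong (λ s → o ++ g s) (here-≔ w r t))) ⇝-act

  ⇒-on-≡ : ∀ {r f g t t′} → moveWrite (f (Tape.here t)) t ≡ t′ →
    r ∶ on r f g ⊢ t ⇒ t′ ▹ g (Tape.here t)
  ⇒-on-≡ {r} {f} {g} {t} eq = subst (λ t′ → r ∶ on r f g ⊢ t ⇒ t′ ▹ _) eq (⇒-on t)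

  infixr 5 _⇒-⨾_

  _⇒-⨾_ : ∀ {r P Q t t′ t″ o o′} → r ∶ P ⊢ t ⇒ t′ ▹ o → r ∶ Q ⊢ t′ ⇒ t″ ▹ o′ →
    r ∶ P ⨾ Q ⊢ t ⇒ t″ ▹ (o ++ o′)
  _⇒-⨾_ {r} {P} {Q} {t″ = t″} {o} {o′} (local p) (local q) = local λ i w o₀ →
    ⇝-emitted (List.++-assoc o₀ o o′)
    (⇝-⨾ (p i w o₀) (q i w (o₀ ++ o)))

  opaque
    unfolding whileAt

    ⇒-while-false : ∀ {r c P t} → c (Tape.here t) ≡ false → r ∶ whileAt r c P ⊢ t ⇒ t ▹ []
    ⇒-while-false {r} {c} {P} {t} h = local λ i w o → ⇝-emitted (sym (List.++-identityʳ o))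
      (⇝-while-false (trans (cong c (here-≔ w r t)) h))

    ⇒-while-true : ∀ {r c P t t′ t″ o o′} → c (Tape.here t) ≡ true →
      r ∶ P ⊢ t ⇒ t′ ▹ o → r ∶ whileAt r c P ⊢ t′ ⇒ t″ ▹ o′ →
      r ∶ whileAt r c P ⊢ t ⇒ t″ ▹ (o ++ o′)
    ⇒-while-true {r} {c} {P} {t} {t″ = t″} {o} {o′} h (local p) (local q) = local λ i w o₀ →
      ⇝-emitted (List.++-assoc o₀ o o′)
        (⇝-while-true (trans (cong c (here-≔ w r t)) h) (p i w o₀) (q i w (o₀ ++ o)))

  go-right go-left : Fin R → Program R
  go-right r = on r (_, right) silent
  go-left  r = on r (_, left) silent

  forward : Fin R → (Bool → List Letter) → Program R
  forward r g = whileAt r is-just (on r (_, right) (maybe g []))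

  -- With `just` for `h` the digits are retraced, with a constant `nothing` they are erased;
  -- printing, incrementing and clearing share this return pass.
  backward : Fin R → (Bool → Symbol) → Program R
  backward r h = whileAt r is-just (on r (λ s → (s >>= h) , left) silent)

  ⇒-forward : ∀ {r g} ds z l → r ∶ forward r g ⊢ past l (pad ds z) ⇒
    past (ds ʳ++ l) (pad [] z) ▹ concatMap g ds
  ⇒-forward []       0       l = ⇒-while-false refl
  ⇒-forward []       (suc z) l = ⇒-while-false refl
  ⇒-forward (b ∷ ds) z       l =
    ⇒-while-true refl (⇒-on-≡ (move-right l b (pad (b ∷ ds) z))) (⇒-forward ds z (b ∷ l))

  ⇒-backward : ∀ {r h} l cs → r ∶ backward r h ⊢ upon l cs ⇒
    tape [] nothing (List.map h l ʳ++ cs) ▹ []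
  ⇒-backward         []      cs = ⇒-while-false refl
  ⇒-backward {h = h} (b ∷ l) cs =
    ⇒-while-true refl (⇒-on-≡ (move-left-upon b l (h b) cs)) (⇒-backward l (h b ∷ cs))

  print : Fin R → Program R
  print r = go-right r ⨾ forward r (λ b → [ bit b ]) ⨾
    on r (_, left) (λ _ → [ stop ]) ⨾ backward r just

  -- The end of a number is visible only as a blank under the head, so that at least one blank cell
  -- exists afterwards: `suc (pred z)` is the maximum of `z` and 1.
  turn : ∀ {r g} l z → r ∶ on r (_, left) g ⊢ past l (pad [] z) ⇒
    upon l (pad [] (suc (pred z))) ▹ g nothing
  turn {r} {g} l z = subst (λ s → r ∶ on r (_, left) g ⊢ past l (pad [] z) ⇒
      upon l (pad [] (suc (pred z))) ▹ g s) (first-blank z)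
    (⇒-on-≡ (trans (move-left l _ (pad [] z))
      (cong (upon l) (trans (cong (_∷ rest (pad [] z)) (first-blank z)) (blank∷rest z)))))

  ⇒-print : ∀ {r} v z → r ∶ print r ⊢ home (bits (fromℕ v)) z ⇒
    home (bits (fromℕ v)) (suc (pred z)) ▹ describeℕ v
  ⇒-print {r} v z = subst₂ (λ cs o → r ∶ print r ⊢ home ds z ⇒ tape [] nothing cs ▹ o)
    (map-ʳ++ just ds [] _)
    (cong (_++ [ stop ]) (digits-bits (fromℕ v)))
    (⇒-on-≡ (leave-home ds z) ⇒-⨾ ⇒-forward ds z [] ⇒-⨾ turn (ds ʳ++ []) z ⇒-⨾
     ⇒-backward (ds ʳ++ []) (pad [] (suc (pred z))))
    where ds = bits (fromℕ v)

  clear : Fin R → Program R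
  clear r = go-right r ⨾ forward r (λ _ → []) ⨾ go-left r ⨾ backward r (λ _ → nothing)

  ⇒-clear : ∀ {r} ds z → r ∶ clear r ⊢ home ds z ⇒ home [] (length ds + suc (pred z)) ▹ []
  ⇒-clear {r} ds z = subst₂ (λ cs o → r ∶ clear r ⊢ home ds z ⇒ tape [] nothing cs ▹ o)
    (trans (map-ʳ++ (λ _ → nothing) ds [] _) (map-nothing ds _))
    (cong (_++ []) (concatMap-[] ds))
    (⇒-on-≡ (leave-home ds z) ⇒-⨾ ⇒-forward ds z [] ⇒-⨾ turn (ds ʳ++ []) z ⇒-⨾
     ⇒-backward (ds ʳ++ []) (pad [] (suc (pred z))))

  carry : Fin R → Program R
  carry r = whileAt r is-two (on r (λ _ → just false , right) silent)

  increment : Fin R → Program R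
  increment r = go-right r ⨾ carry r ⨾
    on r (λ s → successor s , left) silent ⨾ backward r just

  -- The digits already passed are kept in `l`. A cell is added only if the new numeral is longer
  -- than the visited part of the tape, which is what the maximum records.
  ⇒-carry : ∀ {r} x z l → ∃ λ l′ → ∃ λ cs → ∃ λ z′ →
    r ∶ carry r ⊢ past l (pad (bits x) z) ⇒ past l′ cs ▹ [] ×
    List.map just l′ ʳ++ (successor (first cs) ∷ rest cs) ≡
      List.map just l ʳ++ pad (bits (sucᵇ x)) z′ ×
    length (bits (sucᵇ x)) + z′ ≤ (length (bits x) + z) ⊔ length (bits (sucᵇ x))
  ⇒-carry zero 0 l = l , [] , 0 , ⇒-while-false refl , refl , s≤s z≤n
  ⇒-carry zero (suc z) l = l , pad [] (suc z) , z , ⇒-while-false refl , refl , ℕ.m≤m⊔n _ 1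
  ⇒-carry 1+[2 x ] z l = l , pad (bits 1+[2 x ]) z , z , ⇒-while-false refl , refl ,
    ℕ.m≤m⊔n _ (suc (length (bits x)))
  ⇒-carry 2[1+ x ] z l with ⇒-carry x z (false ∷ l)
  ... | l′ , cs , z′ , p , eq , le = l′ , cs , z′ ,
    ⇒-while-true refl (⇒-on-≡ (move-right l false (pad (bits 2[1+ x ]) z))) p , eq , s≤s le

  ⇒-increment : ∀ {r} v z → ∃ λ z′ →
    r ∶ increment r ⊢ home (bits (fromℕ v)) z ⇒ home (bits (fromℕ (suc v))) z′ ▹ [] ×
    length (bits (fromℕ (suc v))) + z′ ≤ (length (bits (fromℕ v)) + z) ⊔ length (bits (fromℕ (suc v)))
  ⇒-increment {r} v z rewrite fromℕ-suc v with ⇒-carry {r} (fromℕ v) z []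
  ... | l , cs , z′ , p , eq , le = z′ ,
    subst (λ cs → r ∶ increment r ⊢ home (bits (fromℕ v)) z ⇒ tape [] nothing cs ▹ []) eq
      (⇒-on-≡ (leave-home (bits (fromℕ v)) z) ⇒-⨾ p ⇒-⨾
       ⇒-on-≡ (move-left l (successor (first cs)) cs) ⇒-⨾ ⇒-backward l _) ,
    le

-- Comparison and loops

_≟ₛ_ : DecidableEquality Symbol
_≟ₛ_ = Maybe.≡-dec Bool._≟_

-- Two blanks neither agree nor differ: a scan has to stop at the common end of two numbers, and
-- these are then equal.
agree differ : Symbol → Symbol → Bool
agree (just x) (just y) = does (x Bool.≟ y)
agree _        _        = false
differ s s′ = not (does (s ≟ₛ s′))

module _ {R : ℕ} where

  opaque

    whileBoth : Fin R → Fin R → (Symbol → Symbol → Bool) → Program R → Program R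
    whileBoth r b c = while (λ _ v → c (lookup v r) (lookup v b))

    both : Fin R → Fin R → Move → Program R
    both r b m = act λ _ v → action tt stay
      (Vec.map (_, stay) v [ r ]≔ (lookup v r , m) [ b ]≔ (lookup v b , m)) []

  module _ {r b : Fin R} (r≢b : r ≢ b) where

    placed : Vec (Tape Symbol) R → Tape Symbol × Tape Symbol → Vec (Tape Symbol) R
    placed w (t , u) = w [ r ]≔ t [ b ]≔ u

    lookup-fst : ∀ w t u → lookup (placed w (t , u)) r ≡ t
    lookup-fst w t u = trans (Vec.lookup∘updateAt′ r b r≢b (w [ r ]≔ t)) (Vec.lookup∘updateAt r w)

    lookup-snd : ∀ w t u → lookup (placed w (t , u)) b ≡ u
    lookup-snd w t u = Vec.lookup∘updateAt b (w [ r ]≔ t)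

    here-fst : ∀ w t u → lookup (Vec.map Tape.here (placed w (t , u))) r ≡ Tape.here t
    here-fst w t u = trans (Vec.lookup-map r Tape.here (placed w (t , u)))
      (cong Tape.here (lookup-fst w t u))

    here-snd : ∀ w t u → lookup (Vec.map Tape.here (placed w (t , u))) b ≡ Tape.here u
    here-snd w t u = trans (Vec.lookup-map b Tape.here (placed w (t , u)))
      (cong Tape.here (lookup-snd w t u))

    overwrite : ∀ w t u t′ u′ → placed (placed w (t , u)) (t′ , u′) ≡ (placed w (t′ , u′))
    overwrite w t u t′ u′ = begin
      w [ r ]≔ t [ b ]≔ u [ r ]≔ t′ [ b ]≔ u′
        ≡⟨ cong (_[ b ]≔ u′) (Vec.[]≔-commutes (w [ r ]≔ t) b r (r≢b ∘ sym)) ⟩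
      w [ r ]≔ t [ r ]≔ t′ [ b ]≔ u [ b ]≔ u′
        ≡⟨ Vec.[]≔-idempotent (w [ r ]≔ t [ r ]≔ t′) b ⟩
      w [ r ]≔ t [ r ]≔ t′ [ b ]≔ u′
        ≡⟨ cong (_[ b ]≔ u′) (Vec.[]≔-idempotent w r) ⟩
      w [ r ]≔ t′ [ b ]≔ u′ ∎
      where open ≡-Reasoning

    zipWith-both : ∀ m w t u → let W = placed w (t , u); v = Vec.map Tape.here W in
      Vec.zipWith moveWrite
        (Vec.map (_, stay) v [ r ]≔ (lookup v r , m) [ b ]≔ (lookup v b , m)) W
      ≡ placed w (moveWrite (Tape.here t , m) t , moveWrite (Tape.here u , m) u)
    zipWith-both m w t u = begin
      Vec.zipWith moveWrite
        (Vec.map (_, stay) v [ r ]≔ (lookup v r , m) [ b ]≔ (lookup v b , m)) W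
        ≡⟨ zipWith-[]≔ moveWrite (Vec.map (_, stay) v [ r ]≔ (lookup v r , m)) W b _ ⟩
      Vec.zipWith moveWrite (Vec.map (_, stay) v [ r ]≔ (lookup v r , m)) W
        [ b ]≔ moveWrite (lookup v b , m) (lookup W b)
        ≡⟨ cong (_[ b ]≔ moveWrite (lookup v b , m) (lookup W b))
             (zipWith-[]≔ moveWrite (Vec.map (_, stay) v) W r _) ⟩
      Vec.zipWith moveWrite (Vec.map (_, stay) v) W
        [ r ]≔ moveWrite (lookup v r , m) (lookup W r)
        [ b ]≔ moveWrite (lookup v b , m) (lookup W b)
        ≡⟨ cong₂ (λ x y → Vec.zipWith moveWrite (Vec.map (_, stay) v) W [ r ]≔ x [ b ]≔ y)
             (cong₂ (λ s → moveWrite (s , m)) (here-fst w t u) (lookup-fst w t u))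
             (cong₂ (λ s → moveWrite (s , m)) (here-snd w t u) (lookup-snd w t u)) ⟩
      placed (Vec.zipWith moveWrite (Vec.map (_, stay) v) W) (t′ , u′)
        ≡⟨ cong (λ w → placed w (t′ , u′)) (zipWith-idle W) ⟩
      placed W (t′ , u′)
        ≡⟨ overwrite w t u t′ u′ ⟩
      placed w (t′ , u′) ∎
      where
      open ≡-Reasoning
      W = placed w (t , u)
      v = Vec.map Tape.here W
      t′ = moveWrite (Tape.here t , m) t
      u′ = moveWrite (Tape.here u , m) u

    infix 3 _⊢_⇉_

    record _⊢_⇉_ (P : Program R) (t t′ : Tape Symbol × Tape Symbol) : Set where
      constructor local
      field
        globalise : ∀ i w o → P ⊢ memory i (placed w t) o ⇝ memory i (placed w t′) o

    _⇉-⨾_ : ∀ {P Q t t′ t″} → P ⊢ t ⇉ t′ → Q ⊢ t′ ⇉ t″ → P ⨾ Q ⊢ t ⇉ t″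
    local p ⇉-⨾ local q = local λ i w o → ⇝-⨾ (p i w o) (q i w o)

    opaque
      unfolding both whileBoth

      ⇉-both : ∀ {m t u t′ u′} → moveWrite (Tape.here t , m) t ≡ t′ →
        moveWrite (Tape.here u , m) u ≡ u′ → both r b m ⊢ (t , u) ⇉ (t′ , u′)
      ⇉-both {m} {t} {u} refl refl = local λ i w o →
        subst (λ μ → both r b m ⊢ memory i (placed w (t , u)) o ⇝ μ)
          (cong₂ (memory i) (zipWith-both m w t u) (List.++-identityʳ o)) ⇝-act

      ⇉-while-false : ∀ {c P t u} → c (Tape.here t) (Tape.here u) ≡ false →
        whileBoth r b c P ⊢ (t , u) ⇉ (t , u)
      ⇉-while-false {c} {P} {t} {u} h = local λ i w o →
        ⇝-while-false (trans (cong₂ c (here-fst w t u) (here-snd w t u)) h)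

      ⇉-while-true : ∀ {c P t u t′ t″} → c (Tape.here t) (Tape.here u) ≡ true →
        P ⊢ (t , u) ⇉ t′ → whileBoth r b c P ⊢ t′ ⇉ t″ → whileBoth r b c P ⊢ (t , u) ⇉ t″
      ⇉-while-true {c} {P} {t} {u} h (local p) (local q) = local λ i w o →
        ⇝-while-true (trans (cong₂ c (here-fst w t u) (here-snd w t u)) h) (p i w o) (q i w o)

  -- After compare, the heads are on the first digits that differ.

  compare rewind : Fin R → Fin R → Program R
  compare r b = both r b right ⨾ whileBoth r b agree (both r b right)
  rewind  r b = both r b left ⨾ whileBoth r b (λ s _ → is-just s) (both r b left)

  module _ {r b : Fin R} (r≢b : r ≢ b) where

    -- The induction needs an arbitrary common prefix `l` already passed. The two equations say that
    -- no digit is lost, so the tapes can be restored later; the last two components say that the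
    -- symbols scanned at the stopping point decide whether the numbers are equal.
    ⇉-scan : ∀ xs ys y z l → ∃ λ l′ → ∃ λ xs′ → ∃ λ ys′ →
      _⊢_⇉_ r≢b (whileBoth r b agree (both r b right))
        (past l (pad xs y) , past l (pad ys z)) (past l′ (pad xs′ y) , past l′ (pad ys′ z)) ×
      l′ ʳ++ xs′ ≡ l ʳ++ xs × l′ ʳ++ ys′ ≡ l ʳ++ ys ×
      (xs ≡ ys → differ (first (pad xs′ y)) (first (pad ys′ z)) ≡ false) ×
      (xs ≢ ys → differ (first (pad xs′ y)) (first (pad ys′ z)) ≡ true)
    ⇉-scan [] [] y z l = l , [] , [] , ⇉-while-false r≢b stop-eq , refl , refl ,
      (λ _ → blanks-agree) , (λ []≢[] → ⊥-elim ([]≢[] refl))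
      where
      stop-eq : agree (first (pad [] y)) (first (pad [] z)) ≡ false
      stop-eq rewrite first-blank y = refl
      blanks-agree : differ (first (pad [] y)) (first (pad [] z)) ≡ false
      blanks-agree rewrite first-blank y | first-blank z = refl
    ⇉-scan [] (b ∷ ys) y z l = l , [] , b ∷ ys , ⇉-while-false r≢b stop-eq , refl , refl ,
      (λ ()) , (λ _ → differs)
      where
      stop-eq : agree (first (pad [] y)) (just b) ≡ false
      stop-eq rewrite first-blank y = refl
      differs : differ (first (pad [] y)) (just b) ≡ true
      differs rewrite first-blank y = refl
    ⇉-scan (a ∷ xs) [] y z l = l , a ∷ xs , [] , ⇉-while-false r≢b stop-eq , refl , refl ,
      (λ ()) , (λ _ → differs)
      where
      stop-eq : agree (just a) (first (pad [] z)) ≡ false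
      stop-eq rewrite first-blank z = refl
      differs : differ (just a) (first (pad [] z)) ≡ true
      differs rewrite first-blank z = refl
    ⇉-scan (a ∷ xs) (b ∷ ys) y z l with a Bool.≟ b
    ... | no a≢b = l , a ∷ xs , b ∷ ys , ⇉-while-false r≢b (dec-false (a Bool.≟ b) a≢b) , refl , refl ,
      (λ eq → ⊥-elim (a≢b (List.∷-injectiveˡ eq))) ,
      (λ _ → cong not (dec-false (just a ≟ₛ just b) (a≢b ∘ Maybe.just-injective)))
    ... | yes refl with ⇉-scan xs ys y z (a ∷ l)
    ...   | l′ , xs′ , ys′ , p , eq , eq′ , same , other = l′ , xs′ , ys′ ,
      ⇉-while-true r≢b (dec-true (a Bool.≟ a) refl)
        (⇉-both r≢b (move-right l a (pad (a ∷ xs) y)) (move-right l a (pad (a ∷ ys) z))) p ,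
      eq , eq′ , same ∘ List.∷-injectiveʳ , (λ ≢ → other (≢ ∘ cong (a ∷_)))

    -- Both heads are equally far from home, so a test on the tape of `r` alone tells when both have
    -- arrived.
    ⇉-rewind : ∀ l cs ds → _⊢_⇉_ r≢b (rewind r b) (past l cs , past l ds)
      (tape [] nothing (List.map just l ʳ++ (first cs ∷ rest cs)) ,
       tape [] nothing (List.map just l ʳ++ (first ds ∷ rest ds)))
    ⇉-rewind l cs ds = _⇉-⨾_ r≢b
      (⇉-both r≢b (move-left l (first cs) cs) (move-left l (first ds) ds))
      (go l (first cs ∷ rest cs) (first ds ∷ rest ds))
      where
      go : ∀ l cs ds →
        _⊢_⇉_ r≢b (whileBoth r b (λ s _ → is-just s) (both r b left)) (upon l cs , upon l ds)
          (tape [] nothing (List.map just l ʳ++ cs) , tape [] nothing (List.map just l ʳ++ ds))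
      go []      cs ds = ⇉-while-false r≢b refl
      go (a ∷ l) cs ds = ⇉-while-true r≢b refl
        (⇉-both r≢b (move-left-upon a l (just a) cs) (move-left-upon a l (just a) ds))
        (go l (just a ∷ cs) (just a ∷ ds))

module _ {R : ℕ} where

  emits : List Letter → Program R
  emits o = act λ _ v → action tt stay (Vec.map (_, stay) v) o

  -- The test of a `while` sees only the scanned symbols and cannot compare two numbers. So the
  -- comparison is made before the test, its outcome is kept in the positions of the heads, and it
  -- is undone after the test. The final `clear` leaves the counter at 0, ready for the next run of
  -- the same loop.
  for-body for : Fin R → Fin R → Program R → Program R
  for-body r b P = while (λ _ v → differ (lookup v r) (lookup v b))
    (rewind r b ⨾ P ⨾ increment r ⨾ compare r b)
  for r b P = compare r b ⨾ for-body r b P ⨾ rewind r b ⨾ clear r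

-- A tape storing a number below 2 ^ w has at most 2 + w cells.

record Stores (w v : ℕ) (t : Tape Symbol) : Set where
  constructor stores
  field
    fits   : v < 2 ^ w
    blanks : ℕ
    layout : t ≡ home (bits (fromℕ v)) blanks
    short  : length (bits (fromℕ v)) + blanks ≤ suc w

stores-more : ∀ {w v z z′} → v < 2 ^ w → length (bits (fromℕ v)) + z ≤ suc w →
  length (bits (fromℕ v)) + z′ ≤ (length (bits (fromℕ v)) + z) ⊔ suc (length (bits (fromℕ v))) →
  Stores w v (home (bits (fromℕ v)) z′)
stores-more {w} {v} v<2^w short le = stores v<2^w _ refl
  (ℕ.≤-trans le (ℕ.⊔-lub short (s≤s (length-bits-≤ {v} {w} v<2^w))))

suc-pred-≤ : ∀ l z → l + suc (pred z) ≤ (l + z) ⊔ suc l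
suc-pred-≤ l 0       = ℕ.≤-trans (ℕ.≤-reflexive (ℕ.+-comm l 1)) (ℕ.m≤n⊔m (l + 0) (suc l))
suc-pred-≤ l (suc z) = ℕ.m≤m⊔n _ _

pad-ʳ++ : ∀ l xs z ds → l ʳ++ xs ≡ ds → List.map just l ʳ++ pad xs z ≡ pad ds z
pad-ʳ++ []      xs z ds refl = refl
pad-ʳ++ (a ∷ l) xs z ds eq   = pad-ʳ++ l (a ∷ xs) z ds eq

-- Programs as operations on registers

module _ {R : ℕ} (w : ℕ) where

  record Holds (e : Vec ℕ R) (ts : Vec (Tape Symbol) R) : Set where
    constructor hold
    field
      contents : ∀ x → Stores w (lookup e x) (lookup ts x)

  holds-[]≔ : ∀ {e ts x v t} → Holds e ts → Stores w v t → Holds (e [ x ]≔ v) (ts [ x ]≔ t)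
  holds-[]≔ {e} {ts} {x} {v} {t} (hold h) s = hold contents
    where
    contents : ∀ y → Stores w (lookup (e [ x ]≔ v) y) (lookup (ts [ x ]≔ t) y)
    contents y with y Fin.≟ x
    ... | yes refl = subst₂ (Stores w) (sym (Vec.lookup∘updateAt y e)) (sym (Vec.lookup∘updateAt y ts)) s
    ... | no y≢x   = subst₂ (Stores w) (sym (Vec.lookup∘updateAt′ y x y≢x e))
                     (sym (Vec.lookup∘updateAt′ y x y≢x ts)) (h y)

  -- `Holds` hides the blank cells, so that specifications mention numbers only. The new tapes are
  -- chosen before `i` and `o₀`, as they depend on neither.
  record Computes (P : Program R) (e e′ : Vec ℕ R) (o : List Letter) : Set where
    constructor computes
    field
      execution : ∀ {ts} → Holds e ts → ∃ λ ts′ → Holds e′ ts′ ×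
        ∀ i o₀ → P ⊢ memory i ts o₀ ⇝ memory i ts′ (o₀ ++ o)

  computes-⨾ : ∀ {P Q e e′ e″ o o′} → Computes P e e′ o → Computes Q e′ e″ o′ →
    Computes (P ⨾ Q) e e″ (o ++ o′)
  computes-⨾ {o = o} {o′} (computes p) (computes q) = computes λ h →
    let ts′ , h′ , p-run = p h; ts″ , h″ , q-run = q h′ in
    ts″ , h″ , λ i o₀ → ⇝-emitted (List.++-assoc o₀ o o′) (⇝-⨾ (p-run i o₀) (q-run i (o₀ ++ o)))

  globally : ∀ {r P o v e t′} ts → r ∶ P ⊢ lookup ts r ⇒ t′ ▹ o → Holds e ts → Stores w v t′ →
    ∃ λ ts′ → Holds (e [ r ]≔ v) ts′ × ∀ i o₀ → P ⊢ memory i ts o₀ ⇝ memory i ts′ (o₀ ++ o)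
  globally {r} {P} {o} {v} {e} {t′} ts (local p) h s = ts [ r ]≔ t′ , holds-[]≔ h s , λ i o₀ →
    subst (λ u → P ⊢ memory i u o₀ ⇝ memory i (ts [ r ]≔ t′) (o₀ ++ o))
      (Vec.[]≔-lookup ts r) (p i ts o₀)

  computes-print : ∀ r e → Computes (print r) e e (describeℕ (lookup e r))
  computes-print r e = computes λ {ts} h → helper ts h (Holds.contents h r)
    where
    v = lookup e r
    helper : ∀ ts → Holds e ts → Stores w v (lookup ts r) → ∃ λ ts′ → Holds e ts′ ×
      ∀ i o₀ → print r ⊢ memory i ts o₀ ⇝ memory i ts′ (o₀ ++ describeℕ v)
    helper ts h (stores fits z layout short)
      with globally ts (subst (λ t → r ∶ print r ⊢ t ⇒ _ ▹ describeℕ v) (sym layout) (⇒-print v z)) h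
             (stores-more {w} {v} {z} fits short (suc-pred-≤ (length (bits (fromℕ v))) z))
    ... | ts′ , h′ , p = ts′ , subst (λ e → Holds e ts′) (Vec.[]≔-lookup e r) h′ , p

  computes-clear : ∀ r e → Computes (clear r) e (e [ r ]≔ 0) []
  computes-clear r e = computes λ {ts} h → helper ts h (Holds.contents h r)
    where
    v = lookup e r
    helper : ∀ ts → Holds e ts → Stores w v (lookup ts r) → ∃ λ ts′ → Holds (e [ r ]≔ 0) ts′ ×
      ∀ i o₀ → clear r ⊢ memory i ts o₀ ⇝ memory i ts′ (o₀ ++ [])
    helper ts h (stores fits z layout short) = globally ts
      (subst (λ t → r ∶ clear r ⊢ t ⇒ _ ▹ []) (sym layout) (⇒-clear (bits (fromℕ v)) z)) h
      (stores (ℕ.m^n>0 2 w) _ refl (ℕ.≤-trans (suc-pred-≤ (length (bits (fromℕ v))) z)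
        (ℕ.⊔-lub short (s≤s (length-bits-≤ {v} {w} fits)))))

  computes-increment : ∀ r e → suc (lookup e r) < 2 ^ w →
    Computes (increment r) e (e [ r ]≔ suc (lookup e r)) []
  computes-increment r e suc-fits = computes λ {ts} h → helper ts h (Holds.contents h r)
    where
    v = lookup e r
    helper : ∀ ts → Holds e ts → Stores w v (lookup ts r) → ∃ λ ts′ → Holds (e [ r ]≔ suc v) ts′ ×
      ∀ i o₀ → increment r ⊢ memory i ts o₀ ⇝ memory i ts′ (o₀ ++ [])
    helper ts h (stores fits z layout short) with ⇒-increment {r = r} v z
    ... | z′ , p , le = globally ts
      (subst (λ t → r ∶ increment r ⊢ t ⇒ _ ▹ []) (sym layout) p) h
      (stores suc-fits z′ refl (ℕ.≤-trans le
        (ℕ.⊔-lub short (ℕ.m≤n⇒m≤1+n (length-bits-≤ {suc v} {w} suc-fits)))))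

  computes-emits : ∀ o e → Computes (emits o) e e o
  computes-emits o e = computes λ {ts} h → ts , h , λ i o₀ →
    subst (λ u → emits o ⊢ memory i ts o₀ ⇝ memory i u (o₀ ++ o)) (zipWith-idle ts) ⇝-act

  -- The situation between compare r b and rewind r b.

  record Compared (r b : Fin R) (e : Vec ℕ R) (ts : Vec (Tape Symbol) R) : Set where
    field
      {restored} : Vec (Tape Symbol) R
      restores   : ∀ i o → rewind r b ⊢ memory i ts o ⇝ memory i restored o
      holds-e    : Holds e restored
    test : Bool
    test = differ (lookup (Vec.map Tape.here ts) r) (lookup (Vec.map Tape.here ts) b)
    field
      equal   : lookup e r ≡ lookup e b → test ≡ false
      unequal : lookup e r ≢ lookup e b → test ≡ true

  ⇝-compare : ∀ {r b e ts} → r ≢ b → Holds e ts →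
    ∃ λ ts′ → Compared r b e ts′ × ∀ i o → compare r b ⊢ memory i ts o ⇝ memory i ts′ o
  ⇝-compare {r} {b} {e} {ts} r≢b h = helper (Holds.contents h r) (Holds.contents h b)
    where
    x = lookup e r
    y = lookup e b
    helper : Stores w x (lookup ts r) → Stores w y (lookup ts b) →
      ∃ λ ts′ → Compared r b e ts′ × ∀ i o → compare r b ⊢ memory i ts o ⇝ memory i ts′ o
    helper (stores fits z layout short) (stores fits′ z′ layout′ short′)
      with ⇉-scan r≢b (bits (fromℕ x)) (bits (fromℕ y)) z z′ []
    ... | l , xs , ys , scan , eq , eq′ , same , other
      with first∷rest-pad xs z | first∷rest-pad ys z′
    ... | z₁ , eq₁ , le₁ | z₂ , eq₂ , le₂ = ts′ , record
      { restores = λ i o → _⊢_⇉_.globalise (⇉-rewind r≢b l (pad xs z) (pad ys z′)) i ts o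
      ; holds-e  = subst (λ e → Holds e _) restore-e
          (holds-[]≔ (holds-[]≔ h (stored fits eq short eq₁ le₁)) (stored fits′ eq′ short′ eq₂ le₂))
      ; equal    = λ x≡y → trans heads (same (cong (bits ∘ fromℕ) x≡y))
      ; unequal  = λ x≢y → trans heads (other (x≢y ∘ ℕᵇ.fromℕ-injective ∘ bits-injective))
      } , λ i o → subst (λ u → compare r b ⊢ memory i u o ⇝ memory i ts′ o) restore-ts
        (_⊢_⇉_.globalise (_⇉-⨾_ r≢b
          (⇉-both r≢b (leave-home (bits (fromℕ x)) z) (leave-home (bits (fromℕ y)) z′)) scan) i ts o)
      where
      ts′ = placed r≢b ts (past l (pad xs z) , past l (pad ys z′))
      heads : differ (lookup (Vec.map Tape.here ts′) r) (lookup (Vec.map Tape.here ts′) b)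
        ≡ differ (first (pad xs z)) (first (pad ys z′))
      heads = cong₂ differ (here-fst r≢b ts _ _) (here-snd r≢b ts _ _)
      restore-e : e [ r ]≔ x [ b ]≔ y ≡ e
      restore-e = trans (cong (_[ b ]≔ y) (Vec.[]≔-lookup e r)) (Vec.[]≔-lookup e b)
      restore-ts : placed r≢b ts (home (bits (fromℕ x)) z , home (bits (fromℕ y)) z′) ≡ ts
      restore-ts = trans
        (cong₂ (λ t u → ts [ r ]≔ t [ b ]≔ u) (sym layout) (sym layout′))
        (trans (cong (_[ b ]≔ lookup ts b) (Vec.[]≔-lookup ts r)) (Vec.[]≔-lookup ts b))
      stored : ∀ {v xs z z₁} → v < 2 ^ w → l ʳ++ xs ≡ bits (fromℕ v) →
        length (bits (fromℕ v)) + z ≤ suc w → first (pad xs z) ∷ rest (pad xs z) ≡ pad xs z₁ →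
        length xs + z₁ ≤ (length xs + z) ⊔ suc (length xs) →
        Stores w v (tape [] nothing (List.map just l ʳ++ (first (pad xs z) ∷ rest (pad xs z))))
      stored {v} {xs} {z} {z₁} fits eq short eq₁ le = subst (λ cs → Stores w v (tape [] nothing cs))
        (sym (trans (cong (List.map just l ʳ++_) eq₁) (pad-ʳ++ l xs z₁ _ eq)))
        (stores-more {w} {v} {z} fits short (longer z z₁ le))
        where
        total : length (bits (fromℕ v)) ≡ length l + length xs
        total = trans (cong length (sym eq)) (List.length-ʳ++ l)
        longer : ∀ z z₁ → length xs + z₁ ≤ (length xs + z) ⊔ suc (length xs) →
          length (bits (fromℕ v)) + z₁ ≤ (length (bits (fromℕ v)) + z) ⊔ suc (length (bits (fromℕ v)))
        longer z z₁ le rewrite total = begin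
          length l + length xs + z₁                                  ≡⟨ ℕ.+-assoc (length l) _ _ ⟩
          length l + (length xs + z₁)                                ≤⟨ ℕ.+-monoʳ-≤ (length l) le ⟩
          length l + ((length xs + z) ⊔ suc (length xs))
            ≡⟨ ℕ.+-distribˡ-⊔ (length l) _ _ ⟩
          (length l + (length xs + z)) ⊔ (length l + suc (length xs))
            ≡⟨ cong₂ _⊔_ (sym (ℕ.+-assoc (length l) _ _)) (ℕ.+-suc (length l) _) ⟩
          (length l + length xs + z) ⊔ suc (length l + length xs) ∎
          where open ℕ.≤-Reasoning

  module _ {r b : Fin R} (r≢b : r ≢ b) (P : Program R) where

    -- Induction on the number `k` of remaining rounds; each round shifts `E` and `o`, and the
    -- offset `j` absorbs the shift of the counter. A run of `P` ends with the counter at its old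
    -- value `j + i`, and the subsequent `increment` completes `E (suc i)`.
    ⇝-for-body : ∀ k j (E : ℕ → Vec ℕ R) (o : ℕ → List Letter) →
      (∀ i → lookup (E i) r ≡ j + i) → (∀ i → lookup (E i) b ≡ j + k) →
      (∀ i → i < k → Computes P (E i) (E (suc i) [ r ]≔ (j + i)) (o i)) →
      ∀ {ts} → Compared r b (E 0) ts → ∃ λ ts′ → Compared r b (E k) ts′ ×
        ∀ i o₀ → for-body r b P ⊢ memory i ts o₀ ⇝ memory i ts′ (o₀ ++ concat (applyUpTo o k))
    ⇝-for-body 0 j E o E-r E-b body {ts} cmp = ts , cmp , λ i o₀ →
      ⇝-emitted (sym (List.++-identityʳ o₀))
        (⇝-while-false (Compared.equal cmp (trans (E-r 0) (sym (E-b 0)))))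
    ⇝-for-body (suc k) j E o E-r E-b body {ts} cmp =
      let ts₁ , h₁ , run₁ = Computes.execution (body 0 (s≤s z≤n)) (Compared.holds-e cmp)
          ts₂ , h₂ , run₂ = Computes.execution (computes-increment r (E 1 [ r ]≔ (j + 0)) fits) h₁
          ts₃ , cmp₃ , run₃ = ⇝-compare r≢b (subst (λ e → Holds e ts₂) next h₂)
          ts₄ , cmp₄ , run₄ = ⇝-for-body k (suc j) (E ∘ suc) (o ∘ suc)
             (λ i → trans (E-r (suc i)) (ℕ.+-suc j i))
             (λ i → trans (E-b (suc i)) (ℕ.+-suc j k))
             (λ i i<k → subst (λ v → Computes P (E (suc i)) (E (suc (suc i)) [ r ]≔ v) (o (suc i)))
               (ℕ.+-suc j i) (body (suc i) (s≤s i<k))) cmp₃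
      in ts₄ , cmp₄ , λ i o₀ → ⇝-emitted (List.++-assoc o₀ (o 0) _)
        (⇝-while-true (Compared.unequal cmp continues)
          (⇝-⨾ (Compared.restores cmp i o₀) (⇝-⨾ (run₁ i o₀) (⇝-⨾
            (⇝-emitted (List.++-identityʳ (o₀ ++ o 0)) (run₂ i (o₀ ++ o 0))) (run₃ i (o₀ ++ o 0)))))
          (run₄ i (o₀ ++ o 0)))
      where
      -- The new counter value is at most the bound, which fits because register `b` stores it.
      fits : suc (lookup (E 1 [ r ]≔ (j + 0)) r) < 2 ^ w
      fits = begin-strict
        suc (lookup (E 1 [ r ]≔ (j + 0)) r) ≡⟨ cong suc (Vec.lookup∘updateAt r (E 1)) ⟩
        suc (j + 0)                       ≡⟨ ℕ.+-suc j 0 ⟨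
        j + 1                             ≤⟨ ℕ.+-monoʳ-≤ j (s≤s z≤n) ⟩
        j + suc k                         ≡⟨ E-b 0 ⟨
        lookup (E 0) b                    <⟨ Stores.fits (Holds.contents (Compared.holds-e cmp) b) ⟩
        2 ^ w                             ∎
        where open ℕ.≤-Reasoning
      open ≡-Reasoning
      next : E 1 [ r ]≔ (j + 0) [ r ]≔ suc (lookup (E 1 [ r ]≔ (j + 0)) r) ≡ E 1
      next = begin
        E 1 [ r ]≔ (j + 0) [ r ]≔ suc (lookup (E 1 [ r ]≔ (j + 0)) r) ≡⟨ Vec.[]≔-idempotent (E 1) r ⟩
        E 1 [ r ]≔ suc (lookup (E 1 [ r ]≔ (j + 0)) r)
          ≡⟨ cong (λ v → E 1 [ r ]≔ suc v) (Vec.lookup∘updateAt r (E 1)) ⟩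
        E 1 [ r ]≔ suc (j + 0)  ≡⟨ cong (E 1 [ r ]≔_) (trans (E-r 1) (ℕ.+-suc j 0)) ⟨
        E 1 [ r ]≔ lookup (E 1) r ≡⟨ Vec.[]≔-lookup (E 1) r ⟩
        E 1 ∎
      continues : lookup (E 0) r ≢ lookup (E 0) b
      continues eq = ℕ.m≢1+m+n j (begin
        j               ≡⟨ ℕ.+-identityʳ j ⟨
        j + 0           ≡⟨ E-r 0 ⟨
        lookup (E 0) r  ≡⟨ eq ⟩
        lookup (E 0) b  ≡⟨ E-b 0 ⟩
        j + suc k       ≡⟨ ℕ.+-suc j k ⟩
        suc (j + k)     ∎)

    computes-for : ∀ n (E : ℕ → Vec ℕ R) (o : ℕ → List Letter) →
      (∀ i → lookup (E i) r ≡ i) → (∀ i → lookup (E i) b ≡ n) →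
      (∀ i → i < n → Computes P (E i) (E (suc i) [ r ]≔ i) (o i)) →
      Computes (for r b P) (E 0) (E n [ r ]≔ 0) (concatMap o (upTo n))
    computes-for n E o E-r E-b body = computes λ h →
      let ts₁ , cmp₁ , run₁ = ⇝-compare r≢b h
          ts₂ , cmp₂ , run₂ = ⇝-for-body n 0 E o E-r E-b body cmp₁
          ts₃ , h₃ , run₃ = Computes.execution (computes-clear r (E n)) (Compared.holds-e cmp₂)
      in ts₃ , h₃ , λ i o₀ → ⇝-emitted
        (trans (List.++-identityʳ _) (cong (λ os → o₀ ++ concat os) (sym (List.map-applyUpTo (λ i → i) o n))))
        (⇝-⨾ (run₁ i o₀) (⇝-⨾ (run₂ i o₀) (⇝-⨾ (Compared.restores cmp₂ i _) (run₃ i _))))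

-- The circuits

-- The order is that of a loop counter. Cutting off at `m` gives a meaning to every limit `c`.
below : ∀ m → ℕ → List (Fin m)
below zero    _       = []
below (suc m) zero    = []
below (suc m) (suc c) = zero ∷ List.map suc (below m c)

toℕ-below : ∀ {m c} → c ≤ m → List.map toℕ (below m c) ≡ upTo c
toℕ-below {zero}  z≤n       = refl
toℕ-below {suc m} z≤n       = refl
toℕ-below {suc m} {suc c} (s≤s c≤m) = cong (0 ∷_) (begin
  List.map toℕ (List.map suc (below m c)) ≡⟨ List.map-∘ (below m c) ⟨
  List.map (suc ∘ toℕ) (below m c)        ≡⟨ List.map-∘ (below m c) ⟩
  List.map suc (List.map toℕ (below m c)) ≡⟨ cong (List.map suc) (toℕ-below c≤m) ⟩
  List.map suc (upTo c)                   ≡⟨ List.map-applyUpTo (λ i → i) suc c ⟩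
  applyUpTo suc c                         ∎)
  where open ≡-Reasoning

length-below : ∀ m c → length (below m c) ≤ m
length-below zero    _       = z≤n
length-below (suc m) zero    = z≤n
length-below (suc m) (suc c) = s≤s (ℕ.≤-trans
  (ℕ.≤-reflexive (List.length-map suc (below m c))) (length-below m c))

-- With κ = true, the sequences are strictly decreasing.

next : Bool → ∀ {m} → Fin m → ℕ → ℕ
next κ i c = if κ then toℕ i else c

sequences : Bool → ∀ {m} d → ℕ → List (Vec (Fin m) d)
sequences κ     zero    c = [ [] ]
sequences κ {m} (suc d) c =
  concatMap (λ i → List.map (i ∷_) (sequences κ d (next κ i c))) (below m c)

length-concatMap-≤ : ∀ {A B : Set} (f : A → List B) {b} → (∀ a → length (f a) ≤ b) →
  ∀ xs → length (concatMap f xs) ≤ length xs * b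
length-concatMap-≤ f         le []       = z≤n
length-concatMap-≤ f {b = b} le (x ∷ xs) = begin
  length (f x ++ concatMap f xs)         ≡⟨ List.length-++ (f x) ⟩
  length (f x) + length (concatMap f xs) ≤⟨ ℕ.+-mono-≤ (le x) (length-concatMap-≤ f le xs) ⟩
  b + length xs * b                      ∎
  where open ℕ.≤-Reasoning

length-sequences : ∀ κ {m} d c → length (sequences κ {m} d c) ≤ m ^ d
length-sequences κ     zero    c = ℕ.≤-refl
length-sequences κ {m} (suc d) c = ℕ.≤-trans
  (length-concatMap-≤ _ (λ i → ℕ.≤-trans
    (ℕ.≤-reflexive (List.length-map (i ∷_) (sequences κ d (next κ i c))))
    (length-sequences κ d (next κ i c))) (below m c))
  (ℕ.*-monoˡ-≤ (m ^ d) (length-below m c))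

Term : ℕ → ℕ → ℕ → ℕ → Set
Term p q m n = Vec (Fin m) p × Vec (Fin n) q × Vec (Fin m) q

-- The innermost `concatMap` over singletons gives all three levels the form that `adds-nest` yields
-- for a nest of loops.
terms : ∀ p q m n → List (Term p q m n)
terms p q m n =
  concatMap (λ v → concatMap (λ c → concatMap (λ u → [ v , c , u ])
    (sequences false q m)) (sequences true q n)) (sequences true p m)

-- In row v_a, the entry of column c_b is 1; in row u_b, it is 0.

literals : ∀ {X Y : Set} {p q} → Vec X p → Vec Y q → Vec X q → List (Bool × X × Y)
literals v c u = concatMap (λ a → List.map (λ b → true , a , b) (toList c)) (toList v)
  ++ List.map (λ (a , b) → false , a , b) (toList (Vec.zip u c))

length-literals : ∀ {X Y : Set} {p q} (v : Vec X p) (c : Vec Y q) u →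
  length (literals v c u) ≡ p * q + q
length-literals {p = p} {q} v c u = begin
  length (literals v c u) ≡⟨ List.length-++ (concatMap f (toList v)) ⟩
  length (concatMap f (toList v)) + length (List.map _ (toList (Vec.zip u c)))
    ≡⟨ cong₂ _+_ (go v) (trans (List.length-map _ (toList (Vec.zip u c)))
         (Vec.length-toList (Vec.zip u c))) ⟩
  p * q + q ∎
  where
  open ≡-Reasoning
  f = λ a → List.map (λ b → true , a , b) (toList c)
  go : ∀ {p} (v : Vec _ p) → length (concatMap f (toList v)) ≡ p * q
  go []      = refl
  go (a ∷ v) = trans (List.length-++ (f a))
    (cong₂ _+_ (trans (List.length-map _ (toList c)) (Vec.length-toList c)) (go v))

toWire : ∀ {X g} → Bool × X → Wire X g
toWire (s , x) = literal s x

conjunctions : ∀ {X} (ts : List (List (Bool × X))) → Gates X (length ts)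
conjunctions []       = []
conjunctions (t ∷ ts) = conjunctions ts ▷ AND (List.map toWire t)

dnf : ∀ {X} → List (List (Bool × X)) → Circuit X
dnf ts = circuit (conjunctions ts ▷ OR (List.map gate (below (length ts) (length ts)))) (gate zero)

-- Depth and size of the circuits

depth-dnf : ∀ {X} (ts : List (List (Bool × X))) → depth (dnf ts) ≤ 2
depth-dnf {X} ts = s≤s (deepest-≤ (onGates (conjunctions ts)) (conjunctions-≤ ts)
  (below (length ts) (length ts)))
  where
  open Interpretation {X} (λ _ _ → 0) (λ ds → suc (foldr _⊔_ 0 ds))
    (λ ds → suc (foldr _⊔_ 0 ds)) suc
  deepest-≤ : ∀ {g} (ρ : Vec ℕ g) → (∀ i → lookup ρ i ≤ 1) → ∀ js →
    foldr _⊔_ 0 (List.map (onWire ρ) (List.map gate js)) ≤ 1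
  deepest-≤ ρ h []       = z≤n
  deepest-≤ ρ h (i ∷ js) = ℕ.⊔-lub (h i) (deepest-≤ ρ h js)
  literals-0 : ∀ {g} (ρ : Vec ℕ g) t →
    foldr _⊔_ 0 (List.map (onWire ρ) (List.map toWire t)) ≡ 0
  literals-0 ρ []      = refl
  literals-0 ρ (_ ∷ t) = literals-0 ρ t
  conjunctions-≤ : ∀ ts i → lookup (onGates (conjunctions ts)) i ≤ 1
  conjunctions-≤ (t ∷ ts) zero    = s≤s (ℕ.≤-reflexive (literals-0 (onGates (conjunctions ts)) t))
  conjunctions-≤ (t ∷ ts) (suc i) = conjunctions-≤ ts i

-- The sum over the gates is local to `size`, so the induction runs through whole circuits: each AND
-- gate in turn takes the place of the last gate `h`.
size-conjunctions : ∀ {X ℓ} {ts : List (List (Bool × X))} → All (λ t → length t ≤ ℓ) ts → ∀ h w →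
  size (circuit (conjunctions ts ▷ h) w) ≤ length ts * suc ℓ + suc (fanIn h)
size-conjunctions         []                 h w = ℕ.≤-refl
size-conjunctions {ℓ = ℓ} (_∷_ {t} {ts} l≤ℓ ls) h w = ℕ.+-monoˡ-≤ (suc (fanIn h)) (begin
  size (circuit (conjunctions ts ▷ AND (List.map toWire t)) (gate zero))
    ≤⟨ size-conjunctions ls (AND (List.map toWire t)) (gate zero) ⟩
  length ts * suc ℓ + suc (length (List.map (toWire {g = length ts}) t))
    ≡⟨ cong (λ k → length ts * suc ℓ + suc k) (List.length-map (toWire {g = length ts}) t) ⟩
  length ts * suc ℓ + suc (length t)               ≤⟨ ℕ.+-monoʳ-≤ _ (s≤s l≤ℓ) ⟩
  length ts * suc ℓ + suc ℓ                        ≡⟨ ℕ.+-comm _ (suc ℓ) ⟩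
  suc ℓ + length ts * suc ℓ                        ∎)
  where open ℕ.≤-Reasoning

size-dnf : ∀ {X ℓ} {ts : List (List (Bool × X))} → All (λ t → length t ≤ ℓ) ts →
  size (dnf ts) ≤ length ts * suc ℓ + suc (length ts)
size-dnf {ℓ = ℓ} {ts} ls = ℕ.≤-trans
  (size-conjunctions ls (OR (List.map gate (below (length ts) (length ts)))) (gate zero))
  (ℕ.+-monoʳ-≤ (length ts * suc ℓ) (s≤s (ℕ.≤-trans
    (ℕ.≤-reflexive (List.length-map gate (below (length ts) (length ts))))
    (length-below (length ts) (length ts)))))

literalsOf : ∀ {p q m n} → Term p q m n → List (Bool × Matrix m n)
literalsOf (v , c , u) = literals v c u

-- The gates of dnf are in the reverse order of its terms.

family : ∀ p q → Family
family p q m n = dnf (List.map literalsOf (reverse (terms p q m n)))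

family-depth : ∀ p q m n → depth (family p q m n) ≤ 2
family-depth p q m n = depth-dnf (List.map literalsOf (reverse (terms p q m n)))

length-terms : ∀ p q m n → length (terms p q m n) ≤ m ^ p * (n ^ q * m ^ q)
length-terms p q m n = begin
  length (terms p q m n)
    ≤⟨ length-concatMap-≤ _ (λ v → length-concatMap-≤ _ (λ c →
         length-concatMap-≤ {B = Term p q m n} (λ u → [ v , c , u ]) (λ _ → ℕ.≤-refl) (sequences false q m))
         (sequences true q n)) (sequences true p m) ⟩
  length (sequences true {m} p m) *
    (length (sequences true {n} q n) * (length (sequences false {m} q m) * 1))
    ≤⟨ ℕ.*-mono-≤ (length-sequences true p m) (ℕ.*-mono-≤ (length-sequences true q n)
         (ℕ.≤-trans (ℕ.≤-reflexive (ℕ.*-identityʳ _)) (length-sequences false q m))) ⟩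
  m ^ p * (n ^ q * m ^ q) ∎
  where open ℕ.≤-Reasoning

-- The base m * n suffices because a matrix without entries has no terms.

power-bound : ∀ p q m n → m ^ suc p * (n ^ suc q * m ^ suc q) ≤ (m * n) ^ (suc p + (suc q + suc q))
power-bound p q zero    n    = z≤n
power-bound p q (suc m) zero = ℕ.≤-trans (ℕ.≤-reflexive (ℕ.*-zeroʳ (suc m ^ suc p))) z≤n
power-bound p q m@(suc _) n@(suc _) = begin
  m ^ suc p * (n ^ suc q * m ^ suc q)
    ≤⟨ ℕ.*-mono-≤ (ℕ.^-monoˡ-≤ (suc p) (ℕ.m≤m*n m n))
         (ℕ.*-mono-≤ (ℕ.^-monoˡ-≤ (suc q) (ℕ.m≤n*m n m)) (ℕ.^-monoˡ-≤ (suc q) (ℕ.m≤m*n m n))) ⟩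
  (m * n) ^ suc p * ((m * n) ^ suc q * (m * n) ^ suc q)
    ≡⟨ cong ((m * n) ^ suc p *_) (ℕ.^-distribˡ-+-* (m * n) (suc q) (suc q)) ⟨
  (m * n) ^ suc p * (m * n) ^ (suc q + suc q)
    ≡⟨ ℕ.^-distribˡ-+-* (m * n) (suc p) (suc q + suc q) ⟨
  (m * n) ^ (suc p + (suc q + suc q)) ∎
  where open ℕ.≤-Reasoning

family-polynomialSize : ∀ p q → PolynomialSize (family (suc p) (suc q))
-- For N conjunctions of ℓ literals, the AND gates cost N * (1 + ℓ) and the OR gate costs 1 + N,
-- which makes 1 + (2 + ℓ) * N.
family-polynomialSize p q = suc (suc ℓ) , d , λ m n → begin
  size (family (suc p) (suc q) m n)
    ≤⟨ size-dnf {ts = ts m n} (All.map⁺ (All.tabulate λ {(v , c , u)} _ →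
         ℕ.≤-reflexive (length-literals v c u))) ⟩
  length (ts m n) * suc ℓ + suc (length (ts m n)) ≡⟨ cong (λ N → N * suc ℓ + suc N) (length-ts m n) ⟩
  N m n * suc ℓ + suc (N m n)                     ≡⟨ ℕ.+-suc (N m n * suc ℓ) (N m n) ⟩
  suc (N m n * suc ℓ + N m n)                     ≡⟨ cong suc (ℕ.+-comm (N m n * suc ℓ) (N m n)) ⟩
  suc (N m n + N m n * suc ℓ)                     ≡⟨ cong suc (ℕ.*-suc (N m n) (suc ℓ)) ⟨
  suc (N m n * suc (suc ℓ))                       ≡⟨ cong suc (ℕ.*-comm (N m n) (suc (suc ℓ))) ⟩
  suc (suc (suc ℓ) * N m n)
    ≤⟨ s≤s (ℕ.*-monoʳ-≤ (suc (suc ℓ)) (ℕ.≤-trans (length-terms (suc p) (suc q) m n)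
         (power-bound p q m n))) ⟩
  suc (suc (suc ℓ) * (m * n) ^ d)                 ≡⟨ ℕ.+-comm 1 _ ⟩
  suc (suc ℓ) * (m * n) ^ d + 1                   ≤⟨ ℕ.+-monoʳ-≤ _ (s≤s z≤n) ⟩
  suc (suc ℓ) * (m * n) ^ d + suc (suc ℓ)         ∎
  where
  open ℕ.≤-Reasoning
  ℓ d : ℕ
  ℓ = suc p * suc q + suc q
  d = suc p + (suc q + suc q)
  ts : ∀ m n → List (List (Bool × Matrix m n))
  ts m n = List.map literalsOf (reverse (terms (suc p) (suc q) m n))
  N : ℕ → ℕ → ℕ
  N m n = length (terms (suc p) (suc q) m n)
  length-ts : ∀ m n → length (ts m n) ≡ N m n
  length-ts m n = trans (List.length-map literalsOf (reverse (terms (suc p) (suc q) m n)))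
    (List.length-reverse (terms (suc p) (suc q) m n))

-- Nested loops

concatMap-concatMap : ∀ {A B C : Set} (f : B → List C) (g : A → List B) xs →
  concatMap f (concatMap g xs) ≡ concatMap (concatMap f ∘ g) xs
concatMap-concatMap f g []       = refl
concatMap-concatMap f g (x ∷ xs) = trans (List.concatMap-++ f (g x) (concatMap g xs))
  (cong (concatMap f (g x) ++_) (concatMap-concatMap f g xs))

concat-concatMap : ∀ {A B : Set} (f : A → List (List B)) xs →
  concat (concatMap f xs) ≡ concatMap (concat ∘ f) xs
concat-concatMap f []       = refl
concat-concatMap f (x ∷ xs) = trans (sym (List.concat-++ (f x) (concatMap f xs)))
  (cong (concat (f x) ++_) (concat-concatMap f xs))

concatMap-upTo-suc : ∀ {A : Set} (f : ℕ → List A) n →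
  concatMap f (upTo (suc n)) ≡ concatMap f (upTo n) ++ f n
concatMap-upTo-suc f n = begin
  concatMap f (upTo (suc n))          ≡⟨ cong (concatMap f) (List.upTo-∷ʳ n) ⟨
  concatMap f (upTo n ++ [ n ])       ≡⟨ List.concatMap-++ f (upTo n) [ n ] ⟩
  concatMap f (upTo n) ++ (f n ++ []) ≡⟨ cong (concatMap f (upTo n) ++_) (List.++-identityʳ (f n)) ⟩
  concatMap f (upTo n) ++ f n         ∎
  where open ≡-Reasoning

-- Loops count in ℕ, whereas rows and columns live in `Fin m`. Extending `g` by `[]` beyond `m`
-- bridges the gap, and for `c ≤ m` the default value is never met.
concatMap-upTo-below : ∀ {A : Set} {m} (g : Fin m → List A) → ∃ λ (f : ℕ → List A) →
  (∀ i → f (toℕ i) ≡ g i) × (∀ {c} → c ≤ m → concatMap f (upTo c) ≡ concatMap g (below m c))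
concatMap-upTo-below {A} {m} g = f , f-toℕ , λ {c} c≤m → begin
  concatMap f (upTo c)                       ≡⟨ cong (concatMap f) (toℕ-below c≤m) ⟨
  concatMap f (List.map toℕ (below m c))     ≡⟨ List.concatMap-map f toℕ (below m c) ⟩
  concatMap (f ∘ toℕ) (below m c)            ≡⟨ List.concatMap-cong f-toℕ (below m c) ⟩
  concatMap g (below m c)                    ∎
  where
  open ≡-Reasoning
  f : ℕ → List A
  f i with i ℕ.<? m
  ... | yes i<m = g (fromℕ< i<m)
  ... | no  _   = []
  f-toℕ : ∀ i → f (toℕ i) ≡ g i
  f-toℕ i with toℕ i ℕ.<? m
  ... | yes i<m = cong g (Fin.fromℕ<-toℕ i i<m)
  ... | no  i≮m = ⊥-elim (i≮m (Fin.toℕ<n i))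

-- By this naturality, one function `literals` serves the program, where the entries are registers,
-- the description, where they are numbers, and the circuit, where they are rows and columns.
literals-map : ∀ {p q} {X Y X′ Y′ : Set} (f : X → X′) (g : Y → Y′)
  (v : Vec X p) (c : Vec Y q) (u : Vec X q) →
  literals (Vec.map f v) (Vec.map g c) (Vec.map f u) ≡
    List.map (λ (s , x , y) → s , f x , g y) (literals v c u)
literals-map {X = X} {Y} f g v c u = begin
  concatMap (λ a → List.map (λ b → true , a , b) (toList (Vec.map g c))) (toList (Vec.map f v))
    ++ List.map (λ (a , b) → false , a , b) (toList (Vec.zip (Vec.map f u) (Vec.map g c)))
    ≡⟨ cong₂ _++_ positives negatives ⟩
  List.map h (concatMap (λ a → List.map (λ b → true , a , b) (toList c)) (toList v))
    ++ List.map h (List.map (λ (a , b) → false , a , b) (toList (Vec.zip u c)))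
    ≡⟨ List.map-++ h (concatMap (λ a → List.map (λ b → true , a , b) (toList c)) (toList v)) _ ⟨
  List.map h (literals v c u) ∎
  where
  open ≡-Reasoning
  h : Bool × X × Y → _
  h (s , x , y) = s , f x , g y
  positives : concatMap (λ a → List.map (λ b → true , a , b) (toList (Vec.map g c))) (toList (Vec.map f v))
    ≡ List.map h (concatMap (λ a → List.map (λ b → true , a , b) (toList c)) (toList v))
  positives = begin
    concatMap (λ a → List.map (λ b → true , a , b) (toList (Vec.map g c))) (toList (Vec.map f v))
      ≡⟨ cong (concatMap _) (Vec.toList-map f v) ⟩
    concatMap (λ a → List.map (λ b → true , a , b) (toList (Vec.map g c))) (List.map f (toList v))
      ≡⟨ List.concatMap-map _ f (toList v) ⟩
    concatMap (λ a → List.map (λ b → true , f a , b) (toList (Vec.map g c))) (toList v)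
      ≡⟨ List.concatMap-cong (λ a → trans (cong (List.map _) (Vec.toList-map g c))
           (trans (sym (List.map-∘ (toList c))) (List.map-∘ (toList c)))) (toList v) ⟩
    concatMap (λ a → List.map h (List.map (λ b → true , a , b) (toList c))) (toList v)
      ≡⟨ List.map-concatMap h _ (toList v) ⟨
    List.map h (concatMap (λ a → List.map (λ b → true , a , b) (toList c)) (toList v)) ∎
  negatives : List.map (λ (a , b) → false , a , b) (toList (Vec.zip (Vec.map f u) (Vec.map g c)))
    ≡ List.map h (List.map (λ (a , b) → false , a , b) (toList (Vec.zip u c)))
  negatives = begin
    List.map (λ (a , b) → false , a , b) (toList (Vec.zip (Vec.map f u) (Vec.map g c)))
      ≡⟨ cong (List.map _ ∘ toList) (Vec.map-zip f g u c) ⟨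
    List.map (λ (a , b) → false , a , b) (toList (Vec.map (Product.map f g) (Vec.zip u c)))
      ≡⟨ cong (List.map _) (Vec.toList-map (Product.map f g) (Vec.zip u c)) ⟩
    List.map (λ (a , b) → false , a , b) (List.map (Product.map f g) (toList (Vec.zip u c)))
      ≡⟨ List.map-∘ (toList (Vec.zip u c)) ⟨
    List.map (λ (a , b) → false , f a , g b) (toList (Vec.zip u c))
      ≡⟨ List.map-∘ (toList (Vec.zip u c)) ⟩
    List.map h (List.map (λ (a , b) → false , a , b) (toList (Vec.zip u c))) ∎

sign : Bool → Letter
sign s = if s then positive else negative

describeLiteral : Bool × ℕ × ℕ → List Letter
describeLiteral (s , i , j) = sign s ∷ describeℕ i ++ describeℕ j

describeTerm : ∀ {p q m n} → Term p q m n → List Letter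
describeTerm (v , c , u) = and-gate ∷
  concatMap describeLiteral (literals (Vec.map toℕ v) (Vec.map toℕ c) (Vec.map toℕ u))

-- Register 0 counts the gates; the environment e lists the other registers.

module _ {R : ℕ} where

  nest : Bool → ∀ {d} → Vec (Fin R) d → Fin R → Program (suc R) → Program (suc R)
  nest κ []       b P = P
  nest κ (r ∷ rs) b P = for (suc r) (suc b) (nest κ rs (if κ then r else b) P)

  printLiterals : List (Bool × Fin R × Fin R) → Program (suc R)
  printLiterals []                 = emits []
  printLiterals ((s , r , c) ∷ ls) =
    emits [ sign s ] ⨾ print (suc r) ⨾ print (suc c) ⨾ printLiterals ls

  lookups : Vec ℕ R → Bool × Fin R × Fin R → Bool × ℕ × ℕ
  lookups e (s , r , c) = s , lookup e r , lookup e c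

  printTerm : ∀ {p q} → Vec (Fin R) p → Vec (Fin R) q → Vec (Fin R) q → Program (suc R)
  printTerm rows cols wits = emits [ and-gate ] ⨾ printLiterals (literals rows cols wits) ⨾ increment zero


module _ {R : ℕ} (w : ℕ) where

  computes-≡ : ∀ {S} {P : Program S} {e e′ o o′} → o ≡ o′ → Computes w P e e′ o → Computes w P e e′ o′
  computes-≡ refl c = c

  -- Each element of `xs` is meant to describe one gate, so the gate counter rises by `length xs`.
  -- All other registers get their values back, which is what allows nesting.
  record Adds (P : Program (suc R)) (e : Vec ℕ R) (xs : List (List Letter)) : Set where
    constructor adds
    field
      computation : ∀ g → g + length xs < 2 ^ w →
        Computes w P (g ∷ e) (g + length xs ∷ e) (concat xs)

  adds-≡ : ∀ {P e xs ys} → xs ≡ ys → Adds P e xs → Adds P e ys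
  adds-≡ refl a = a

  -- The counter of the loop starts and ends at 0, so `e` is restored. The gate counter changes
  -- along the way: before round i it has advanced by the `count i` gates of the earlier rounds.
  adds-for : ∀ {r b P e} → r ≢ b → lookup e r ≡ 0 → (f : ℕ → List (List Letter)) →
    (∀ i → i < lookup e b → Adds P (e [ r ]≔ i) (f i)) →
    Adds (for (suc r) (suc b) P) e (concatMap f (upTo (lookup e b)))
  adds-for {r} {b} {P} {e} r≢b e-r f body = adds λ g fits →
    subst₂ (λ (E E′ : Vec ℕ (suc R)) → Computes w (for (suc r) (suc b) P) E E′ (concat (concatMap f (upTo n))))
      (cong₂ _∷_ (ℕ.+-identityʳ g) e-0)
      (cong (_ ∷_) (trans (Vec.[]≔-idempotent e r) e-0))
      (subst (Computes w (for (suc r) (suc b) P) (E g 0) (E g n [ suc r ]≔ 0))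
        (sym (concat-concatMap f (upTo n)))
        (computes-for w (r≢b ∘ Fin.suc-injective) P n (E g) (concat ∘ f)
          (λ i → Vec.lookup∘updateAt r e)
          (λ i → Vec.lookup∘updateAt′ b r (r≢b ∘ sym) e)
          (λ i i<n → iteration g fits i i<n (Adds.computation (body i i<n) (g + count i)))))
    where
    n = lookup e b
    count : ℕ → ℕ
    count i = length (concatMap f (upTo i))
    E : ℕ → ℕ → Vec ℕ (suc R)
    E g i = g + count i ∷ e [ r ]≔ i
    e-0 : e [ r ]≔ 0 ≡ e
    e-0 = trans (cong (e [ r ]≔_) (sym e-r)) (Vec.[]≔-lookup e r)
    count-suc : ∀ i → count (suc i) ≡ count i + length (f i)
    count-suc i = trans (cong length (concatMap-upTo-suc f i)) (List.length-++ (concatMap f (upTo i)))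
    count-mono : ∀ {i j} → i ≤ j → count i ≤ count j
    count-mono {j = j} i≤j with ℕ.m≤n⇒m<n∨m≡n i≤j
    ... | inj₂ refl = ℕ.≤-refl
    count-mono {j = suc j} i≤j | inj₁ (s≤s i<j) = ℕ.≤-trans (count-mono i<j)
      (ℕ.≤-trans (ℕ.m≤m+n (count j) _) (ℕ.≤-reflexive (sym (count-suc j))))
    iteration : ∀ g → g + count n < 2 ^ w → ∀ i → i < n →
      (g + count i + length (f i) < 2 ^ w →
        Computes w P (E g i) (g + count i + length (f i) ∷ e [ r ]≔ i) (concat (f i))) →
      Computes w P (E g i) (E g (suc i) [ suc r ]≔ i) (concat (f i))
    iteration g fits i i<n c = subst (λ E′ → Computes w P (E g i) E′ (concat (f i)))
      (cong₂ _∷_ total (sym (Vec.[]≔-idempotent e r)))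
      (c (ℕ.≤-trans (s≤s (ℕ.≤-trans (ℕ.≤-reflexive total) (ℕ.+-monoʳ-≤ g (count-mono i<n)))) fits))
      where
      total : g + count i + length (f i) ≡ g + count (suc i)
      total = trans (ℕ.+-assoc g (count i) _) (cong (g +_) (sym (count-suc i)))

  Unchanged : ∀ {d} → Vec (Fin R) d → Vec ℕ R → Vec ℕ R → Set
  Unchanged rs e e′ = ∀ x → AllV (x ≢_) rs → lookup e′ x ≡ lookup e x

  -- Uniqueness prevents a loop from overwriting an enclosing counter or the bound. The body is
  -- assumed to work in every environment with `v` in the counters and the values of `e` elsewhere;
  -- this is what a nest placed inside can rely on.
  adds-nest : ∀ κ {m d P e b c} {rs : Vec (Fin R) d} → UniqueV (b ∷ rs) →
    AllV (λ r → lookup e r ≡ 0) rs → lookup e b ≡ c → c ≤ m →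
    (f : Vec (Fin m) d → List (List Letter)) →
    (∀ v e′ → Vec.map (lookup e′) rs ≡ Vec.map toℕ v → Unchanged rs e e′ → Adds P e′ (f v)) →
    Adds (nest κ rs b P) e (concatMap f (sequences κ d c))
  adds-nest κ {e = e} {rs = []} _ _ _ _ f body = adds-≡ (sym (List.++-identityʳ (f [])))
    (body [] e refl (λ _ _ → refl))
  adds-nest κ {m} {suc d} {P} {e} {b} {c} {r ∷ rs}
    ((b≢r ∷ b≢rs) ∷ (r≢rs ∷ rs!)) (e-r ∷ e-rs) refl c≤m f body
    with concatMap-upTo-below {m = m}
           (λ i → concatMap (f ∘ (i ∷_)) (sequences κ d (next κ i c)))
  ... | f′ , f′-toℕ , f′-upTo = adds-≡
    (trans (f′-upTo c≤m) (sym (begin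
      concatMap f (concatMap (λ i → List.map (i ∷_) (sequences κ d (next κ i c))) (below m c))
        ≡⟨ concatMap-concatMap f _ (below m c) ⟩
      concatMap (λ i → concatMap f (List.map (i ∷_) (sequences κ d (next κ i c)))) (below m c)
        ≡⟨ List.concatMap-cong (λ i → List.concatMap-map f (i ∷_) (sequences κ d (next κ i c))) (below m c) ⟩
      concatMap (λ i → concatMap (f ∘ (i ∷_)) (sequences κ d (next κ i c))) (below m c) ∎)))
    (adds-for (b≢r ∘ sym) e-r f′ λ i i<c → iteration (fromℕ< (ℕ.<-≤-trans i<c c≤m)) i
      (Fin.toℕ-fromℕ< (ℕ.<-≤-trans i<c c≤m)) i<c)
    where
    open ≡-Reasoning
    -- The counter `i` and the index `j` are the same number; with the equation as an argument,
    -- `refl` can replace `i` by `toℕ j`.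
    iteration : ∀ (j : Fin m) i → toℕ j ≡ i → i < c →
      Adds (nest κ rs (if κ then r else b) P) (e [ r ]≔ i) (f′ i)
    iteration j i refl i<c = adds-≡ (sym (f′-toℕ j))
      (adds-nest κ (unique κ) (AllV.map unchanged (AllV.zip (r≢rs , e-rs))) (bound κ) (below-m κ) (f ∘ (j ∷_))
        λ v e′ v-eq same → body (j ∷ v) e′
          (cong₂ _∷_ (trans (same r r≢rs) (Vec.lookup∘updateAt r e)) v-eq)
          (λ { x (x≢r ∷ x≢rs) → trans (same x x≢rs) (Vec.lookup∘updateAt′ x r x≢r e) }))
      where
      unchanged : ∀ {x} → r ≢ x × lookup e x ≡ 0 → lookup (e [ r ]≔ i) x ≡ 0
      unchanged {x} (r≢x , e-x) = trans (Vec.lookup∘updateAt′ x r (r≢x ∘ sym) e) e-x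
      unique : ∀ κ → UniqueV ((if κ then r else b) ∷ rs)
      unique true  = r≢rs ∷ rs!
      unique false = b≢rs ∷ rs!
      bound : ∀ κ → lookup (e [ r ]≔ i) (if κ then r else b) ≡ next κ j c
      bound true  = Vec.lookup∘updateAt r e
      bound false = Vec.lookup∘updateAt′ b r b≢r e
      below-m : ∀ κ → next κ j c ≤ m
      below-m true  = ℕ.<⇒≤ (Fin.toℕ<n j)
      below-m false = c≤m

  computes-printLiterals : ∀ ls g (e : Vec ℕ R) → Computes w (printLiterals ls) (g ∷ e) (g ∷ e)
    (concatMap (describeLiteral ∘ lookups e) ls)
  computes-printLiterals []                 g e = computes-emits w [] (g ∷ e)
  computes-printLiterals ((s , r , c) ∷ ls) g e = computes-≡
    (cong (sign s ∷_) (sym (List.++-assoc (describeℕ (lookup e r)) (describeℕ (lookup e c)) _)))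
    (computes-⨾ w (computes-emits w [ sign s ] (g ∷ e))
    (computes-⨾ w (computes-print w (suc r) (g ∷ e))
    (computes-⨾ w (computes-print w (suc c) (g ∷ e)) (computes-printLiterals ls g e))))

  adds-printTerm : ∀ {p q m n e} {rows : Vec (Fin R) p} {cols wits : Vec (Fin R) q} (t : Term p q m n) →
    let v , c , u = t in
    Vec.map (lookup e) rows ≡ Vec.map toℕ v → Vec.map (lookup e) cols ≡ Vec.map toℕ c →
    Vec.map (lookup e) wits ≡ Vec.map toℕ u → Adds (printTerm rows cols wits) e [ describeTerm t ]
  adds-printTerm {e = e} {rows} {cols} {wits} t v-eq c-eq u-eq = adds λ g fits →
    subst₂ (λ g′ o → Computes w (printTerm rows cols wits) (g ∷ e) (g′ ∷ e) o)
      (ℕ.+-comm 1 g) (cong (λ o → (and-gate ∷ o) ++ []) eq)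
      (computes-⨾ w (computes-emits w [ and-gate ] (g ∷ e))
      (computes-⨾ w (computes-printLiterals (literals rows cols wits) g e)
        (computes-increment w zero (g ∷ e) (subst (_< 2 ^ w) (ℕ.+-comm g 1) fits))))
    where
    open ≡-Reasoning
    eq : concatMap (describeLiteral ∘ lookups e) (literals rows cols wits) ≡
      concatMap describeLiteral (literals (Vec.map toℕ (proj₁ t)) (Vec.map toℕ (proj₁ (proj₂ t)))
        (Vec.map toℕ (proj₂ (proj₂ t))))
    eq = begin
      concatMap (describeLiteral ∘ lookups e) (literals rows cols wits)
        ≡⟨ List.concatMap-map describeLiteral (lookups e) (literals rows cols wits) ⟨
      concatMap describeLiteral (List.map (lookups e) (literals rows cols wits))
        ≡⟨ cong (concatMap describeLiteral) (literals-map (lookup e) (lookup e) rows cols wits) ⟨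
      concatMap describeLiteral
        (literals (Vec.map (lookup e) rows) (Vec.map (lookup e) cols) (Vec.map (lookup e) wits))
        ≡⟨ cong (concatMap describeLiteral) (trans
             (cong₂ (λ v c → literals v c (Vec.map (lookup e) wits)) v-eq c-eq)
             (cong (literals (Vec.map toℕ (proj₁ t)) (Vec.map toℕ (proj₁ (proj₂ t)))) u-eq)) ⟩
      _ ∎

-- Uniformity

describe-conjunctions : ∀ {m n} (ts : List (List (Bool × Matrix m n))) →
  describeGates (conjunctions ts) ≡ concatMap (λ t → and-gate ∷
    concatMap describeLiteral (List.map (λ (s , i , j) → s , toℕ i , toℕ j) t)) (reverse ts)
describe-conjunctions         []       = refl
describe-conjunctions {m} {n} (t ∷ ts) = begin
  describeGates (conjunctions ts) ++ and-gate ∷ concatMap describeWire (List.map toWire t)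
    ≡⟨ cong₂ _++_ (describe-conjunctions ts) (cong (and-gate ∷_)
         (trans (List.concatMap-map describeWire (toWire {g = length ts}) t)
           (sym (List.concatMap-map describeLiteral _ t)))) ⟩
  concatMap f (reverse ts) ++ f t            ≡⟨ cong (concatMap f (reverse ts) ++_) (List.++-identityʳ (f t)) ⟨
  concatMap f (reverse ts) ++ concatMap f [ t ] ≡⟨ List.concatMap-++ f (reverse ts) [ t ] ⟨
  concatMap f (reverse ts ++ [ t ])          ≡⟨ cong (concatMap f) (List.unfold-reverse t ts) ⟨
  concatMap f (reverse (t ∷ ts))             ∎
  where
  open ≡-Reasoning
  f : List (Bool × Matrix m n) → List Letter
  f t = and-gate ∷ concatMap describeLiteral (List.map (λ (s , i , j) → s , toℕ i , toℕ j) t)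

wires : ℕ → List Letter
wires N = concatMap (λ i → wire ∷ describeℕ i) (upTo N)

describe-family : ∀ p q m n → describe (family p q m n) ≡
  concatMap describeTerm (terms p q m n) ++ (or-gate ∷ wires (length (terms p q m n))) ++
  output ∷ wire ∷ describeℕ 0
describe-family p q m n = begin
  (describeGates (conjunctions ts) ++ or-gate ∷ concatMap describeWire (List.map gate (below N′ N′))) ++ end
    ≡⟨ List.++-assoc (describeGates (conjunctions ts)) _ end ⟩
  describeGates (conjunctions ts) ++ (or-gate ∷ concatMap describeWire (List.map gate (below N′ N′))) ++ end
    ≡⟨ cong₂ (λ o o′ → o ++ (or-gate ∷ o′) ++ end) gates-eq wires-eq ⟩
  concatMap describeTerm (terms p q m n) ++ (or-gate ∷ wires N) ++ end ∎
  where
  open ≡-Reasoning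
  ts : List (List (Bool × Matrix m n))
  ts = List.map literalsOf (reverse (terms p q m n))
  N N′ : ℕ
  N  = length (terms p q m n)
  N′ = length ts
  end : List Letter
  end = output ∷ wire ∷ describeℕ 0
  f : List (Bool × Matrix m n) → List Letter
  f t = and-gate ∷ concatMap describeLiteral (List.map (λ (s , i , j) → s , toℕ i , toℕ j) t)
  gates-eq : describeGates (conjunctions ts) ≡ concatMap describeTerm (terms p q m n)
  gates-eq = begin
    describeGates (conjunctions ts)                    ≡⟨ describe-conjunctions ts ⟩
    concatMap f (reverse (List.map literalsOf (reverse (terms p q m n))))
      ≡⟨ cong (concatMap f) (trans (sym (List.reverse-map literalsOf (reverse (terms p q m n))))
           (cong (List.map literalsOf) (List.reverse-involutive (terms p q m n)))) ⟩
    concatMap f (List.map literalsOf (terms p q m n))  ≡⟨ List.concatMap-map f literalsOf (terms p q m n) ⟩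
    concatMap (f ∘ literalsOf) (terms p q m n)
      ≡⟨ List.concatMap-cong (λ (v , c , u) → cong (λ ls → and-gate ∷ concatMap describeLiteral ls)
           (sym (literals-map toℕ toℕ v c u))) (terms p q m n) ⟩
    concatMap describeTerm (terms p q m n) ∎
  N′≡N : N′ ≡ N
  N′≡N = trans (List.length-map literalsOf (reverse (terms p q m n))) (List.length-reverse (terms p q m n))
  wires-eq : concatMap describeWire (List.map gate (below N′ N′)) ≡ wires N
  wires-eq = begin
    concatMap describeWire (List.map gate (below N′ N′)) ≡⟨ List.concatMap-map describeWire gate (below N′ N′) ⟩
    concatMap (λ i → wire ∷ describeℕ (toℕ i)) (below N′ N′)
      ≡⟨ List.concatMap-map (λ i → wire ∷ describeℕ i) toℕ (below N′ N′) ⟨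
    concatMap (λ i → wire ∷ describeℕ i) (List.map toℕ (below N′ N′))
      ≡⟨ cong (concatMap (λ i → wire ∷ describeℕ i)) (toℕ-below {N′} ℕ.≤-refl) ⟩
    wires N′ ≡⟨ cong wires N′≡N ⟩
    wires N ∎

-- False at the separator and at the end marker alike, so the same loop counts both blocks of ones.
is-true : Maybe Bool → Bool
is-true (just true) = true
is-true _           = false

-- The head is on the first of k ones, which are followed by c and cs.

block : List (Maybe Bool) → ℕ → Maybe Bool → List (Maybe Bool) → Tape (Maybe Bool)
block l zero    c cs = tape l c cs
block l (suc k) c cs = tape l (just true) (replicate k (just true) ++ c ∷ cs)

module _ {R : ℕ} where

  advance : Program R
  advance = act λ _ v → action tt right (Vec.map (_, stay) v) []

  count : Fin R → Program R
  count r = while (λ i _ → is-true i) (increment r ⨾ advance)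

  ⇝-advance : ∀ {l x y cs ts o} → advance ⊢
    memory (tape l x (y ∷ cs)) ts o ⇝ memory (tape (x ∷ l) y cs) ts o
  ⇝-advance {l} {x} {y} {cs} {ts} {o} = subst₂
    (λ u o′ → advance ⊢ memory (tape l x (y ∷ cs)) ts o ⇝ memory (tape (x ∷ l) y cs) u o′)
    (zipWith-idle ts) (List.++-identityʳ o) ⇝-act

  moveInput-block : ∀ l k c cs →
    moveInput right (block l (suc k) c cs) ≡ block (just true ∷ l) k c cs
  moveInput-block l zero    c cs = refl
  moveInput-block l (suc k) c cs = refl

  ⇝-advance-block : ∀ l k c cs {ts o} → advance ⊢
    memory (block l (suc k) c cs) ts o ⇝ memory (block (just true ∷ l) k c cs) ts o
  ⇝-advance-block l zero    c cs = ⇝-advance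
  ⇝-advance-block l (suc k) c cs = ⇝-advance

  ⇝-count : ∀ w {r c cs} → is-true c ≡ false → ∀ k l e {ts} → Holds w e ts → lookup e r + k < 2 ^ w →
    ∃ λ ts′ → ∃ λ l′ → Holds w (e [ r ]≔ (lookup e r + k)) ts′ ×
      ∀ o → count r ⊢ memory (block l k c cs) ts o ⇝ memory (tape l′ c cs) ts′ o
  ⇝-count w {r} c-false zero l e {ts} h fits = ts , l ,
    subst (λ e → Holds w e ts)
      (sym (trans (cong (e [ r ]≔_) (ℕ.+-identityʳ _)) (Vec.[]≔-lookup e r))) h ,
    λ o → ⇝-while-false c-false
  ⇝-count w {r} {c} {cs} c-false (suc k) l e {ts} h fits =
    let ts₁ , h₁ , run₁ = Computes.execution (computes-increment w r e
          (ℕ.≤-<-trans (ℕ.≤-trans (s≤s (ℕ.m≤m+n (lookup e r) k)) (ℕ.≤-reflexive (sym (ℕ.+-suc _ k)))) fits)) h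
        ts₂ , l′ , h₂ , run₂ = ⇝-count w {r} {c} {cs} c-false k (just true ∷ l)
          (e [ r ]≔ suc (lookup e r)) h₁
          (subst (_< 2 ^ w) (sym shift) fits)
    in ts₂ , l′ ,
      subst (λ e → Holds w e ts₂) (trans (Vec.[]≔-idempotent e r) (cong (e [ r ]≔_) shift)) h₂ ,
      λ o → ⇝-while-true refl
        (⇝-⨾ (⇝-emitted (List.++-identityʳ o) (run₁ (block l (suc k) c cs) o)) (⇝-advance-block l k c cs))
        (run₂ o)
    where
    shift : lookup (e [ r ]≔ suc (lookup e r)) r + k ≡ lookup e r + suc k
    shift = trans (cong (_+ k) (Vec.lookup∘updateAt r e)) (sym (ℕ.+-suc (lookup e r) k))

  space-≤ : ∀ w {e : Vec ℕ R} {ts} → Holds w e ts → Vec.sum (Vec.map Tape.cells ts) ≤ R * (2 + w)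
  space-≤ w {e} {ts} h = sum-≤ ts λ x → cells-≤ (Holds.contents h x)
    where
    cells-≤ : ∀ {v t} → Stores w v t → Tape.cells t ≤ 2 + w
    cells-≤ {v} (stores _ z refl short) = s≤s (ℕ.≤-trans (ℕ.≤-reflexive
      (trans (List.length-++ (List.map just (bits (fromℕ v))))
        (cong₂ _+_ (List.length-map just (bits (fromℕ v))) (List.length-replicate z)))) short)
    sum-≤ : ∀ {n} (ts : Vec (Tape Symbol) n) → (∀ x → Tape.cells (lookup ts x) ≤ 2 + w) →
      Vec.sum (Vec.map Tape.cells ts) ≤ n * (2 + w)
    sum-≤ []       le = z≤n
    sum-≤ (t ∷ ts) le = ℕ.+-mono-≤ (le zero) (sum-≤ ts (le ∘ suc))

↑ˡ≢↑ʳ : ∀ {m n} (i : Fin m) (j : Fin n) → i ↑ˡ n ≢ m ↑ʳ j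
↑ˡ≢↑ʳ {m} {n} i j eq
  with () ← trans (sym (Fin.splitAt-↑ˡ m i n)) (trans (cong (splitAt m) eq) (Fin.splitAt-↑ʳ m n j))

input-ones : ∀ m n → List.map just (unary m n) ++ [ nothing ] ≡
  replicate m (just true) ++ just false ∷ (replicate n (just true) ++ nothing ∷ [])
input-ones m n = begin
  List.map just (replicate m true ++ false ∷ replicate n true) ++ [ nothing ]
    ≡⟨ cong (_++ [ nothing ]) (List.map-++ just (replicate m true) (false ∷ replicate n true)) ⟩
  (List.map just (replicate m true) ++ just false ∷ List.map just (replicate n true)) ++ [ nothing ]
    ≡⟨ List.++-assoc (List.map just (replicate m true)) _ [ nothing ] ⟩
  List.map just (replicate m true) ++ just false ∷ (List.map just (replicate n true) ++ [ nothing ])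
    ≡⟨ cong₂ (λ x y → x ++ just false ∷ (y ++ [ nothing ]))
         (List.map-replicate just m true) (List.map-replicate just n true) ⟩
  replicate m (just true) ++ just false ∷ (replicate n (just true) ++ nothing ∷ []) ∎
  where open ≡-Reasoning

-- The program that prints the circuit

module _ (p q : ℕ) where

  width : ℕ
  width = 3 + (p + (q + q))

  register : Fin (p + (q + q)) → Fin width
  register x = suc (suc (suc x))

  wireCount rowCount colCount : Fin width
  wireCount = zero
  rowCount  = suc zero
  colCount  = suc (suc zero)

  row : Fin p → Fin width
  row a = register (a ↑ˡ (q + q))

  col wit : Fin q → Fin width
  col b = register (p ↑ʳ (b ↑ˡ q))
  wit b = register (p ↑ʳ (q ↑ʳ b))

  rows : Vec (Fin width) p
  rows = tabulate row

  cols wits : Vec (Fin width) q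
  cols = tabulate col
  wits = tabulate wit

  -- The input head starts on the left marker, hence the first `advance`; the second one skips the
  -- separator. After `printTerms`, tape 0 holds the number of conjunctions and serves as the bound
  -- of the loop in `printWires`.
  printTerms printWires generator : Program (suc width)
  printTerms = nest true rows rowCount (nest true cols colCount (nest false wits rowCount
    (printTerm rows cols wits)))
  printWires = for (suc wireCount) zero (emits [ wire ] ⨾ print (suc wireCount))
  generator  = advance ⨾ count (suc rowCount) ⨾ advance ⨾ count (suc colCount) ⨾
    printTerms ⨾ emits [ or-gate ] ⨾ printWires ⨾ emits (output ∷ wire ∷ describeℕ 0)

  register-injective : ∀ {x y} → register x ≡ register y → x ≡ y
  register-injective = Fin.suc-injective ∘ Fin.suc-injective ∘ Fin.suc-injective

  row≢col : ∀ a b → row a ≢ col b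
  row≢col a b = ↑ˡ≢↑ʳ a (b ↑ˡ q) ∘ register-injective

  row≢wit : ∀ a b → row a ≢ wit b
  row≢wit a b = ↑ˡ≢↑ʳ a (q ↑ʳ b) ∘ register-injective

  col≢wit : ∀ a b → col a ≢ wit b
  col≢wit a b = ↑ˡ≢↑ʳ a b ∘ Fin.↑ʳ-injective p _ _ ∘ register-injective

  rows! : UniqueV (rowCount ∷ rows)
  rows! = AllV.tabulate⁺ (λ _ ()) ∷ UniqueV.tabulate⁺ (Fin.↑ˡ-injective (q + q) _ _ ∘ register-injective)

  cols! : UniqueV (colCount ∷ cols)
  cols! = AllV.tabulate⁺ (λ _ ()) ∷
    UniqueV.tabulate⁺ (Fin.↑ˡ-injective q _ _ ∘ Fin.↑ʳ-injective p _ _ ∘ register-injective)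

  wits! : UniqueV (rowCount ∷ wits)
  wits! = AllV.tabulate⁺ (λ _ ()) ∷
    UniqueV.tabulate⁺ (Fin.↑ʳ-injective q _ _ ∘ Fin.↑ʳ-injective p _ _ ∘ register-injective)

  start-environment : ℕ → ℕ → Vec ℕ width
  start-environment m n = 0 ∷ m ∷ n ∷ Vec.replicate (p + (q + q)) 0

  map-tabulate-cong : ∀ {d} {e e′ : Vec ℕ width} (f : Fin d → Fin width) →
    (∀ a → lookup e′ (f a) ≡ lookup e (f a)) →
    Vec.map (lookup e′) (tabulate f) ≡ Vec.map (lookup e) (tabulate f)
  map-tabulate-cong {e = e} {e′} f eq = begin
    Vec.map (lookup e′) (tabulate f) ≡⟨ Vec.tabulate-∘ (lookup e′) f ⟨
    tabulate (lookup e′ ∘ f)         ≡⟨ Vec.tabulate-cong eq ⟩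
    tabulate (lookup e ∘ f)          ≡⟨ Vec.tabulate-∘ (lookup e) f ⟩
    Vec.map (lookup e) (tabulate f)  ∎
    where open ≡-Reasoning

  -- The three groups of counters are disjoint. Thus each nest finds its own counters at 0 and its
  -- bound intact, and the innermost body still finds the outer counters as they were set.
  adds-printTerms : ∀ w m n → Adds w printTerms (start-environment m n)
    (List.map describeTerm (terms p q m n))
  adds-printTerms w m n = adds-≡ w (sym terms-eq)
    (adds-nest w true rows! (AllV.tabulate⁺ (λ a → Vec.lookup-replicate (a ↑ˡ (q + q)) 0)) refl ℕ.≤-refl _
      λ v e₁ v-eq₁ same₁ →
     adds-nest w true cols! (AllV.tabulate⁺ (λ b → trans
         (same₁ (col b) (AllV.tabulate⁺ (λ a → row≢col a b ∘ sym)))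
         (Vec.lookup-replicate (p ↑ʳ (b ↑ˡ q)) 0)))
       (same₁ colCount (AllV.tabulate⁺ (λ _ ()))) ℕ.≤-refl _
      λ c e₂ c-eq₂ same₂ →
     adds-nest w false wits! (AllV.tabulate⁺ (λ b → trans
         (same₂ (wit b) (AllV.tabulate⁺ (λ a → col≢wit a b ∘ sym))) (trans
         (same₁ (wit b) (AllV.tabulate⁺ (λ a → row≢wit a b ∘ sym)))
         (Vec.lookup-replicate (p ↑ʳ (q ↑ʳ b)) 0))))
       (trans (same₂ rowCount (AllV.tabulate⁺ (λ _ ()))) (same₁ rowCount (AllV.tabulate⁺ (λ _ ())))) ℕ.≤-refl _
      λ u e₃ u-eq same₃ → adds-printTerm w (v , c , u)
        (trans (trans
          (map-tabulate-cong {e = e₂} {e₃} row (λ a → same₃ (row a) (AllV.tabulate⁺ (row≢wit a))))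
          (map-tabulate-cong {e = e₁} {e₂} row (λ a → same₂ (row a) (AllV.tabulate⁺ (row≢col a)))))
          v-eq₁)
        (trans
          (map-tabulate-cong {e = e₂} {e₃} col (λ a → same₃ (col a) (AllV.tabulate⁺ (col≢wit a))))
          c-eq₂)
        u-eq)
    where
    terms-eq : List.map describeTerm (terms p q m n) ≡
      concatMap (λ v → concatMap (λ c → concatMap (λ u → [ describeTerm (v , c , u) ])
        (sequences false q m)) (sequences true q n)) (sequences true p m)
    terms-eq = trans (List.map-concatMap describeTerm _ (sequences true p m))
      (List.concatMap-cong (λ v → trans (List.map-concatMap describeTerm _ (sequences true q n))
        (List.concatMap-cong (λ c → List.map-concatMap describeTerm _ (sequences false q m))
          (sequences true q n))) (sequences true p m))

  computes-printWires : ∀ w N (e : Vec ℕ (2 + (p + (q + q)))) →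
    Computes w printWires (N ∷ 0 ∷ e) (N ∷ 0 ∷ e) (wires N)
  computes-printWires w N e = computes-for w (λ ()) _ N (λ i → N ∷ i ∷ e) (λ i → wire ∷ describeℕ i)
    (λ _ → refl) (λ _ → refl)
    (λ i _ → computes-⨾ w (computes-emits w [ wire ] _) (computes-print w (suc wireCount) (N ∷ i ∷ e)))

  letters : ℕ → ℕ → List Letter
  letters m n = concatMap describeTerm (terms p q m n) ++
    (or-gate ∷ wires (length (terms p q m n))) ++ output ∷ wire ∷ describeℕ 0

  computes-output : ∀ w m n → length (terms p q m n) < 2 ^ w →
    Computes w (printTerms ⨾ emits [ or-gate ] ⨾ printWires ⨾ emits (output ∷ wire ∷ describeℕ 0))
      (0 ∷ start-environment m n) (length (terms p q m n) ∷ start-environment m n) (letters m n)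
  computes-output w m n fits = computes-⨾ w
    (subst (λ N → Computes w printTerms (0 ∷ e) (N ∷ e) (concatMap describeTerm ts)) length-ts
      (Adds.computation (adds-printTerms w m n) 0 (subst (_< 2 ^ w) (sym length-ts) fits)))
    (computes-⨾ w (computes-emits w [ or-gate ] (N ∷ e))
    (computes-⨾ w (computes-printWires w N (m ∷ n ∷ Vec.replicate _ 0))
      (computes-emits w (output ∷ wire ∷ describeℕ 0) (N ∷ e))))
    where
    ts = terms p q m n
    N = length ts
    e = start-environment m n
    length-ts : length (List.map describeTerm ts) ≡ N
    length-ts = List.length-map describeTerm ts

  initial-work : Vec (Tape Symbol) (suc width)
  initial-work = Vec.replicate (suc width) (tape [] nothing [])

  initial-holds : ∀ w → Holds w (Vec.replicate (suc width) 0) initial-work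
  initial-holds w = hold {e = Vec.replicate (suc width) 0} λ x → subst₂ (Stores w)
    (sym (Vec.lookup-replicate x 0)) (sym (Vec.lookup-replicate x (tape [] nothing [])))
    (stores (ℕ.m^n>0 2 w) 0 refl z≤n)

  ⇝-enter : ∀ {l x o} {ts : Vec (Tape Symbol) (suc width)} k c cs → advance ⊢
    memory (tape l x (replicate k (just true) ++ c ∷ cs)) ts o ⇝ memory (block (x ∷ l) k c cs) ts o
  ⇝-enter zero    c cs = ⇝-advance
  ⇝-enter (suc k) c cs = ⇝-advance

  ⇝-generator : ∀ w m n → m < 2 ^ w → n < 2 ^ w → length (terms p q m n) < 2 ^ w →
    ∃ λ i → ∃ λ ts → Holds w (length (terms p q m n) ∷ start-environment m n) ts ×
      generator ⊢ memory (tape [] nothing (List.map just (unary m n) ++ [ nothing ])) initial-work [] ⇝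
        memory i ts (letters m n)
  ⇝-generator w m n m-fits n-fits N-fits =
    let ts₁ , l₁ , h₁ , run₁ = ⇝-count w {suc rowCount} {just false} {replicate n (just true) ++ nothing ∷ []}
          refl m [ nothing ] (Vec.replicate (suc width) 0) (initial-holds w) m-fits
        ts₂ , l₂ , h₂ , run₂ = ⇝-count w {suc colCount} {nothing} {[]}
          refl n (just false ∷ l₁) (0 ∷ 0 ∷ m ∷ Vec.replicate _ 0) h₁ n-fits
        ts₃ , h₃ , run₃ = Computes.execution (computes-output w m n N-fits) h₂
    in tape l₂ nothing [] , ts₃ , h₃ ,
      subst (λ cs → generator ⊢ memory (tape [] nothing cs) initial-work [] ⇝
          memory (tape l₂ nothing []) ts₃ (letters m n)) (sym (input-ones m n))
        (⇝-⨾ (⇝-enter m (just false) _) (⇝-⨾ (run₁ []) (⇝-⨾ (⇝-enter n nothing [])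
          (⇝-⨾ (run₂ []) (run₃ (tape l₂ nothing []) [])))))

-- Logarithmic space

n≤2^⌈log₂n⌉ : ∀ n → n ≤ 2 ^ ⌈log₂ n ⌉
n≤2^⌈log₂n⌉ = <-rec (λ n → n ≤ 2 ^ ⌈log₂ n ⌉) bound
  where
  open ℕ.≤-Reasoning
  bound : ∀ n → (∀ {m} → m < n → m ≤ 2 ^ ⌈log₂ m ⌉) → n ≤ 2 ^ ⌈log₂ n ⌉
  bound zero             rec = z≤n
  bound (suc zero)       rec = s≤s z≤n
  bound n@(suc (suc n′)) rec = begin
    n                            ≡⟨ ℕ.⌊n/2⌋+⌈n/2⌉≡n n ⟨
    ⌊ n /2⌋ + ⌈ n /2⌉           ≤⟨ ℕ.+-monoˡ-≤ ⌈ n /2⌉ (ℕ.⌊n/2⌋≤⌈n/2⌉ n) ⟩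
    ⌈ n /2⌉ + ⌈ n /2⌉             ≡⟨ cong (⌈ n /2⌉ +_) (ℕ.+-identityʳ ⌈ n /2⌉) ⟨
    2 * ⌈ n /2⌉                  ≤⟨ ℕ.*-monoʳ-≤ 2 (rec (ℕ.⌈n/2⌉<n n′)) ⟩
    2 * 2 ^ ⌈log₂ ⌈ n /2⌉ ⌉       ≡⟨ cong (λ k → 2 ^ suc k) (⌈log₂⌈n/2⌉⌉≡⌈log₂n⌉∸1 n) ⟩
    2 ^ suc (⌈log₂ n ⌉ ∸ 1)      ≡⟨ cong (2 ^_) (ℕ.m+[n∸m]≡n (⌈log₂⌉-mono-≤ {2} {n} (s≤s (s≤s z≤n)))) ⟩
    2 ^ ⌈log₂ n ⌉                ∎

family-uniform : ∀ p q → LogspaceUniform (family p q)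
family-uniform p q = machine (generator p q) , S * (3 + d) , λ m n →
  let i , ts , h , run steps = ⇝-generator p q (w m n) m n
        (fits m n (ℕ.^-identityʳ m) (ℕ.m≤m+n m (suc n)) (s≤s z≤n))
        (fits m n (ℕ.^-identityʳ n) (ℕ.≤-trans (ℕ.n≤1+n n) (ℕ.m≤n+m (suc n) m)) (s≤s z≤n))
        (ℕ.≤-<-trans (terms-≤ m n) (fits m n refl ℕ.≤-refl (ℕ.n≤1+n _)))
  in configuration nothing i ts (letters p q m n) , steps , refl , sym (describe-family p q m n) ,
     ℕ.≤-trans (space-≤ (w m n) h) (space-bound (k m n))
  where
  open ℕ.≤-Reasoning
  S d : ℕ
  S = suc (width p q)
  -- There are at most L ^ (p + 2q) terms, where L = m + n + 1 is the length of the input. The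
  -- additional 1 makes `d` an admissible exponent for m and n themselves too.
  d = suc (p + (q + q))
  L k w : ℕ → ℕ → ℕ
  L m n = m + suc n
  k m n = ⌈log₂ length (unary m n) ⌉
  -- All stored numbers are at most 2 ^ (d * k); the extra digit makes this a strict bound.
  w m n = suc (d * k m n)
  L≤2^k : ∀ m n → L m n ≤ 2 ^ k m n
  L≤2^k m n = begin
    L m n              ≡⟨ cong₂ (λ a b → a + suc b) (List.length-replicate m) (List.length-replicate n) ⟨
    length (replicate m true) + length (false ∷ replicate n true)
                       ≡⟨ List.length-++ (replicate m true) ⟨
    length (unary m n) ≤⟨ n≤2^⌈log₂n⌉ (length (unary m n)) ⟩
    2 ^ k m n          ∎
  fits : ∀ m n {x y j} → x ^ j ≡ y → x ≤ L m n → j ≤ d → y < 2 ^ w m n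
  fits m n {x} {j = j} refl x≤L j≤d = begin-strict
    x ^ j             ≤⟨ ℕ.^-monoˡ-≤ j (ℕ.≤-trans x≤L (L≤2^k m n)) ⟩
    (2 ^ k m n) ^ j   ≡⟨ ℕ.^-*-assoc 2 (k m n) j ⟩
    2 ^ (k m n * j)   ≤⟨ ℕ.^-monoʳ-≤ 2 (ℕ.*-monoʳ-≤ (k m n) j≤d) ⟩
    2 ^ (k m n * d)   ≡⟨ cong (2 ^_) (ℕ.*-comm (k m n) d) ⟩
    2 ^ (d * k m n)   <⟨ ℕ.^-monoʳ-< 2 (s≤s (s≤s z≤n)) (ℕ.n<1+n (d * k m n)) ⟩
    2 ^ w m n         ∎
  terms-≤ : ∀ m n → length (terms p q m n) ≤ L m n ^ (p + (q + q))
  terms-≤ m n = begin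
    length (terms p q m n)              ≤⟨ length-terms p q m n ⟩
    m ^ p * (n ^ q * m ^ q)
      ≤⟨ ℕ.*-mono-≤ (ℕ.^-monoˡ-≤ p m≤L) (ℕ.*-mono-≤ (ℕ.^-monoˡ-≤ q n≤L) (ℕ.^-monoˡ-≤ q m≤L)) ⟩
    L m n ^ p * (L m n ^ q * L m n ^ q) ≡⟨ cong (L m n ^ p *_) (ℕ.^-distribˡ-+-* (L m n) q q) ⟨
    L m n ^ p * L m n ^ (q + q)         ≡⟨ ℕ.^-distribˡ-+-* (L m n) p (q + q) ⟨
    L m n ^ (p + (q + q))               ∎
    where
    m≤L : m ≤ L m n
    m≤L = ℕ.m≤m+n m (suc n)
    n≤L : n ≤ L m n
    n≤L = ℕ.≤-trans (ℕ.n≤1+n n) (ℕ.m≤n+m (suc n) m)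
  -- There are `S` tapes with at most 2 + w cells each, where w = 1 + d * k.
  space-bound : ∀ k → S * (2 + suc (d * k)) ≤ S * (3 + d) * k + S * (3 + d)
  space-bound k = begin
    S * (3 + d * k)                 ≡⟨ ℕ.*-distribˡ-+ S 3 (d * k) ⟩
    S * 3 + S * (d * k)             ≡⟨ ℕ.+-comm (S * 3) (S * (d * k)) ⟩
    S * (d * k) + S * 3
      ≤⟨ ℕ.+-mono-≤ (ℕ.*-monoʳ-≤ S (ℕ.*-monoˡ-≤ k (ℕ.m≤n+m d 3))) (ℕ.*-monoʳ-≤ S (ℕ.m≤m+n 3 d)) ⟩
    S * ((3 + d) * k) + S * (3 + d) ≡⟨ cong (_+ S * (3 + d)) (ℕ.*-assoc S (3 + d) k) ⟨
    S * (3 + d) * k + S * (3 + d)   ∎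

-- Ceilings of rationals

-- A ceiling is the negated floor of the negated number. Negation of a rational computes only once
-- the sign of the numerator is known, hence the three cases.
ceiling-def : ∀ x → ceiling x ≡ ℤ.- ((ℤ.- ℚ.↥ x) ℤ./ℕ ℚ.↧ₙ x)
ceiling-def (mkℚ (ℤ.+ 0)       d _) = cong ℤ.-_ (ℤ.div-pos-is-/ℕ (ℤ.+ 0) (suc d))
ceiling-def (mkℚ (ℤ.+ (suc n)) d _) = cong ℤ.-_ (ℤ.div-pos-is-/ℕ -[1+ n ] (suc d))
ceiling-def (mkℚ -[1+ n ]    d _) = cong ℤ.-_ (ℤ.div-pos-is-/ℕ (ℤ.+ suc n) (suc d))

-- Together with `ceiling-least`, this characterises the ceiling as the least integer bound, with
-- denominators cleared so that the reasoning stays in the integers.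
↥-≤-ceiling : ∀ x → ℚ.↥ x ℤ.≤ ceiling x ℤ.* ℚ.↧ x
↥-≤-ceiling x@record{} = begin
  ℚ.↥ x                                         ≡⟨ ℤ.neg-involutive (ℚ.↥ x) ⟨
  ℤ.- (ℤ.- ℚ.↥ x)                               ≤⟨ ℤ.neg-mono-≤ (ℤ.[n/ℕd]*d≤n (ℤ.- ℚ.↥ x) (ℚ.↧ₙ x)) ⟩
  ℤ.- ((ℤ.- ℚ.↥ x) ℤ./ℕ ℚ.↧ₙ x ℤ.* ℚ.↧ x)       ≡⟨ ℤ.neg-distribˡ-* ((ℤ.- ℚ.↥ x) ℤ./ℕ ℚ.↧ₙ x) (ℚ.↧ x) ⟩
  (ℤ.- ((ℤ.- ℚ.↥ x) ℤ./ℕ ℚ.↧ₙ x)) ℤ.* ℚ.↧ x     ≡⟨ cong (ℤ._* ℚ.↧ x) (ceiling-def x) ⟨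
  ceiling x ℤ.* ℚ.↧ x                           ∎
  where open ℤ.≤-Reasoning

ceiling-least : ∀ x (c : ℤ) → ℚ.↥ x ℤ.≤ c ℤ.* ℚ.↧ x → ceiling x ℤ.≤ c
ceiling-least x@record{} c le = subst₂ ℤ._≤_ (sym (ceiling-def x)) (ℤ.neg-involutive c)
  (ℤ.neg-mono-≤ (subst (ℤ.- c ℤ.≤_) (ℤ.pred-suc q) (ℤ.i<j⇒i≤pred[j] c<)))
  where
  q = (ℤ.- ℚ.↥ x) ℤ./ℕ ℚ.↧ₙ x
  -- As `q` is the floor of `- x`, its successor exceeds `- x`, which is at least `- c` by
  -- hypothesis. Thus `- c ≤ q` among integers, and negating gives the claim.
  c< : ℤ.- c ℤ.< ℤ.suc q
  c< = ℤ.*-cancelʳ-<-nonNeg (ℚ.↧ x) (begin-strict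
    (ℤ.- c) ℤ.* ℚ.↧ x   ≡⟨ ℤ.neg-distribˡ-* c (ℚ.↧ x) ⟨
    ℤ.- (c ℤ.* ℚ.↧ x)   ≤⟨ ℤ.neg-mono-≤ le ⟩
    ℤ.- ℚ.↥ x           <⟨ ℤ.n<s[n/ℕd]*d (ℤ.- ℚ.↥ x) (ℚ.↧ₙ x) ⟩
    ℤ.suc q ℤ.* ℚ.↧ x   ∎)
    where open ℤ.≤-Reasoning

toℚᵘ-/ : ∀ i n .{{_ : NonZero n}} → ℚ.toℚᵘ (i / n) ≃ i ℚᵘ./ n
toℚᵘ-/ i (suc n) = ℚ.toℚᵘ-fromℚᵘ (mkℚᵘ i n)

≤-integer⇒ : ∀ x (N : ℤ) → x ℚ.≤ N / 1 → ℚ.↥ x ℤ.≤ N ℤ.* ℚ.↧ x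
≤-integer⇒ x@record{} N x≤N
  with *≤* le ← ℚᵘ.≤-respʳ-≃ (toℚᵘ-/ N 1) (ℚ.toℚᵘ-mono-≤ x≤N)
  = subst (ℤ._≤ N ℤ.* ℚ.↧ x) (ℤ.*-identityʳ (ℚ.↥ x)) le

≤-integer⇐ : ∀ x (N : ℤ) → ℚ.↥ x ℤ.≤ N ℤ.* ℚ.↧ x → x ℚ.≤ N / 1
≤-integer⇐ x@record{} N le = ℚ.toℚᵘ-cancel-≤ (ℚᵘ.≤-respʳ-≃ (ℚᵘ.≃-sym (toℚᵘ-/ N 1))
  (*≤* (subst (ℤ._≤ N ℤ.* ℚ.↧ x) (sym (ℤ.*-identityʳ (ℚ.↥ x))) le)))

/-*-cancel : ∀ (N : ℤ) L .{{_ : NonZero L}} → (N / L) ℚ.* (ℤ.+ L / 1) ≡ N / 1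
/-*-cancel N L@(suc _) = ℚ.toℚᵘ-injective (begin
  ℚ.toℚᵘ ((N / L) ℚ.* (ℤ.+ L / 1))             ≈⟨ ℚ.toℚᵘ-homo-* (N / L) (ℤ.+ L / 1) ⟩
  ℚ.toℚᵘ (N / L) ℚᵘ.* ℚ.toℚᵘ (ℤ.+ L / 1)       ≈⟨ ℚᵘ.*-cong (toℚᵘ-/ N L) (toℚᵘ-/ (ℤ.+ L) 1) ⟩
  (N ℚᵘ./ L) ℚᵘ.* (ℤ.+ L ℚᵘ./ 1)               ≈⟨ *≡* cross ⟩
  N ℚᵘ./ 1                                   ≈⟨ toℚᵘ-/ N 1 ⟨
  ℚ.toℚᵘ (N / 1)                             ∎)
  where
  open ℚᵘ.≃-Reasoning
  cross : (N ℤ.* ℤ.+ L) ℤ.* ℤ.+ 1 ≡ N ℤ.* ℤ.+ (L * 1)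
  cross = trans (ℤ.*-identityʳ (N ℤ.* ℤ.+ L)) (cong (λ k → N ℤ.* ℤ.+ k) (sym (ℕ.*-identityʳ L)))

module _ {s : ℚ} {L p : ℕ} .{{_ : NonZero L}} (threshold : ceiling (s ℚ.* (ℤ.+ L / 1)) ≡ ℤ.+ p) where

  -- Multiplying by `L` makes the right side the integer `N`, and a number is at most an integer iff
  -- its ceiling is.
  ≤-fraction⇒ : ∀ {N} → s ℚ.≤ ℤ.+ N / L → p ≤ N
  ≤-fraction⇒ {N} s≤N/L = ℤ.drop‿+≤+ (subst (ℤ._≤ ℤ.+ N) threshold
    (ceiling-least (s ℚ.* (ℤ.+ L / 1)) (ℤ.+ N) (≤-integer⇒ _ (ℤ.+ N)
      (subst (s ℚ.* (ℤ.+ L / 1) ℚ.≤_) (/-*-cancel (ℤ.+ N) L)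
        (ℚ.*-monoʳ-≤-nonNeg (ℤ.+ L / 1) {{ℚ.normalize-nonNeg L 1}} s≤N/L)))))

  ≤-fraction⇐ : ∀ {N} → p ≤ N → s ℚ.≤ ℤ.+ N / L
  ≤-fraction⇐ {N} p≤N = ℚ.*-cancelʳ-≤-pos (ℤ.+ L / 1) {{ℚ.normalize-pos L 1}}
    (subst (s ℚ.* (ℤ.+ L / 1) ℚ.≤_) (sym (/-*-cancel (ℤ.+ N) L))
      (≤-integer⇐ (s ℚ.* (ℤ.+ L / 1)) (ℤ.+ N) (begin
        ℚ.↥ (s ℚ.* (ℤ.+ L / 1))                       ≤⟨ ↥-≤-ceiling (s ℚ.* (ℤ.+ L / 1)) ⟩
        ceiling (s ℚ.* (ℤ.+ L / 1)) ℤ.* ℚ.↧ (s ℚ.* (ℤ.+ L / 1))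
          ≡⟨ cong (ℤ._* ℚ.↧ (s ℚ.* (ℤ.+ L / 1))) threshold ⟩
        ℤ.+ p ℤ.* ℚ.↧ (s ℚ.* (ℤ.+ L / 1))
          ≤⟨ ℤ.*-monoʳ-≤-nonNeg (ℚ.↧ (s ℚ.* (ℤ.+ L / 1))) (ℤ.+≤+ p≤N) ⟩
        ℤ.+ N ℤ.* ℚ.↧ (s ℚ.* (ℤ.+ L / 1))               ∎)))
    where open ℤ.≤-Reasoning

-- Satisfied terms

value : ∀ {X : Set} → (X → Bool) → Bool × X → Bool
value x (s , y) = if s then x y else not (x y)

and-true⁻ : ∀ bs → and bs ≡ true → All (_≡ true) bs
and-true⁻ []          _  = []
and-true⁻ (true ∷ bs) eq = refl ∷ and-true⁻ bs eq

and-true⁺ : ∀ {bs} → All (_≡ true) bs → and bs ≡ true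
and-true⁺ []          = refl
and-true⁺ (refl ∷ bs) = and-true⁺ bs

or-true⁻ : ∀ bs → or bs ≡ true → Any (_≡ true) bs
or-true⁻ (true ∷ bs)  _  = here refl
or-true⁻ (false ∷ bs) eq = there (or-true⁻ bs eq)

or-true⁺ : ∀ {bs} → Any (_≡ true) bs → or bs ≡ true
or-true⁺         (here refl)       = refl
or-true⁺ {true ∷ bs}  (there _)    = refl
or-true⁺ {false ∷ bs} (there any)  = or-true⁺ any

∈-below : ∀ {m c} {i : Fin m} → toℕ i < c → i ∈ below m c
∈-below {suc m} {suc c} {zero}  _         = here refl
∈-below {suc m} {suc c} {suc i} (s≤s i<c) = there (∈-map⁺ suc (∈-below i<c))

below-< : ∀ {m c} {i : Fin m} → i ∈ below m c → toℕ i < c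
below-< {suc m} {suc c} (here refl) = s≤s z≤n
below-< {suc m} {suc c} (there i∈) with _ , j∈ , refl ← ∈-map⁻ suc i∈ = s≤s (below-< j∈)

module _ {X : Set} (x : X → Bool) where

  open Interpretation {X} (λ b i → if b then x i else not (x i)) and or not

  Satisfied : List (Bool × X) → Set
  Satisfied = All (λ l → value x l ≡ true)

  onGates-conjunctions⁻ : ∀ ts i → Vec.lookup (onGates (conjunctions ts)) i ≡ true → Any Satisfied ts
  onGates-conjunctions⁻ (t ∷ ts) zero    eq =
    here (All.map⁻ {f = toWire} (All.map⁻ {f = onWire (onGates (conjunctions ts))}
      (and-true⁻ (List.map (onWire (onGates (conjunctions ts))) (List.map toWire t)) eq)))
  onGates-conjunctions⁻ (t ∷ ts) (suc i) eq = there (onGates-conjunctions⁻ ts i eq)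

  onGates-conjunctions⁺ : ∀ {ts} → Any Satisfied ts →
    ∃ λ i → Vec.lookup (onGates (conjunctions ts)) i ≡ true
  onGates-conjunctions⁺ {t ∷ ts} (here all) = zero ,
    and-true⁺ (All.map⁺ {f = onWire (onGates (conjunctions ts))} (All.map⁺ {f = toWire} all))
  onGates-conjunctions⁺ (there any) =
    let i , eq = onGates-conjunctions⁺ any in suc i , eq

  eval-dnf⁻ : ∀ ts → eval (dnf ts) x ≡ true → Any Satisfied ts
  eval-dnf⁻ ts eq = onGates-conjunctions⁻ ts i i-true
    where
    any : Any (λ i → Vec.lookup (onGates (conjunctions ts)) i ≡ true) (below (length ts) (length ts))
    any = Any.map⁻ {f = gate} (Any.map⁻ {f = onWire (onGates (conjunctions ts))} (or-true⁻ _ eq))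
    i = proj₁ (Any.satisfied any)
    i-true = proj₂ (Any.satisfied any)

  eval-dnf⁺ : ∀ {ts} → Any Satisfied ts → eval (dnf ts) x ≡ true
  eval-dnf⁺ {ts} any = let i , eq = onGates-conjunctions⁺ any in
    or-true⁺ (Any.map⁺ {f = onWire (onGates (conjunctions ts))}
      (Any.map⁺ {f = gate} (lose (∈-below (Fin.toℕ<n i)) eq)))

Decreasing : ∀ {m d} → Vec (Fin m) d → Set
Decreasing v = AllPairs Fin._>_ (toList v)

∈-sequences-true : ∀ {m d c} {v : Vec (Fin m) d} → Decreasing v → All (λ i → toℕ i < c) (toList v) →
  v ∈ sequences true d c
∈-sequences-true {v = []}    []        []        = here refl
∈-sequences-true {v = i ∷ v} (i> ∷ >>) (i<c ∷ _) =
  ∈-concatMap⁺ _ (lose (∈-below i<c) (∈-map⁺ (i ∷_) (∈-sequences-true >> i>)))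

∈-sequences-false : ∀ {m d} (v : Vec (Fin m) d) → v ∈ sequences false d m
∈-sequences-false []      = here refl
∈-sequences-false (i ∷ v) =
  ∈-concatMap⁺ _ (lose (∈-below (Fin.toℕ<n i)) (∈-map⁺ (i ∷_) (∈-sequences-false v)))

sequences-true-∈ : ∀ {m d c} {v : Vec (Fin m) d} → v ∈ sequences true d c →
  Decreasing v × All (λ i → toℕ i < c) (toList v)
sequences-true-∈ {d = zero}  {v = []} _ = [] , []
sequences-true-∈ {m} {d = suc d} {c} v∈
  with i , i∈ , v∈′ ← find (∈-concatMap⁻ (λ i → List.map (i ∷_) (sequences true d (toℕ i))) {xs = below m c} v∈)
  with v , v∈″ , refl ← ∈-map⁻ (i ∷_) v∈′
  with >> , i> ← sequences-true-∈ v∈″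
  = i> ∷ >> , below-< i∈ ∷ All.map (λ j<i → ℕ.<-trans j<i (below-< i∈)) i>

∈-terms⁺ : ∀ {p q m n} {v : Vec (Fin m) p} {c : Vec (Fin n) q} → Decreasing v → Decreasing c →
  ∀ u → (v , c , u) ∈ terms p q m n
∈-terms⁺ {p} {q} {m} {n} {v} {c} v> c> u =
  ∈-concatMap⁺ _ {xs = sequences true p m} (lose (∈-sequences-true v> (bounded v))
  (∈-concatMap⁺ _ {xs = sequences true q n} (lose (∈-sequences-true c> (bounded c))
  (∈-concatMap⁺ _ {xs = sequences false q m} (lose (∈-sequences-false u) (here refl))))))
  where
  bounded : ∀ {m d} (v : Vec (Fin m) d) → All (λ i → toℕ i < m) (toList v)
  bounded v = All.universal Fin.toℕ<n (toList v)

terms-∈ : ∀ {p q m n v c u} → (v , c , u) ∈ terms p q m n → Decreasing v × Decreasing c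
terms-∈ {p} {q} {m} {n} t∈
  with v , v∈ , t∈′ ← find (∈-concatMap⁻ _ {xs = sequences true p m} t∈)
  with c , c∈ , t∈″ ← find (∈-concatMap⁻ _ {xs = sequences true q n} t∈′)
  with u , u∈ , here refl ← find (∈-concatMap⁻ _ {xs = sequences false q m} t∈″)
  = proj₁ (sequences-true-∈ v∈) , proj₁ (sequences-true-∈ c∈)

All-literals⁻ : ∀ {X Y : Set} {P : Bool × X × Y → Set} {p q} (v : Vec X p) (c : Vec Y q) (u : Vec X q) →
  All P (literals v c u) →
  (∀ {a} → a ∈ toList v → ∀ {b} → b ∈ toList c → P (true , a , b)) ×
  (∀ b → P (false , Vec.lookup u b , Vec.lookup c b))
All-literals⁻ {P = P} v c u all =
  (λ a∈ b∈ → All.lookup (All.map⁻ (All.lookup (All.map⁻ (All.concat⁻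
    (All.++⁻ˡ (concatMap _ (toList v)) all))) a∈)) b∈) ,
  λ b → subst (λ (x , y) → P (false , x , y)) (Vec.lookup-zip b u c)
    (AllV.lookup⁺ (AllV.toList⁻ (All.map⁻ (All.++⁻ʳ (concatMap _ (toList v)) all))) b)

All-literals⁺ : ∀ {X Y : Set} {P : Bool × X × Y → Set} {p q} (v : Vec X p) (c : Vec Y q) (u : Vec X q) →
  (∀ {a} → a ∈ toList v → ∀ {b} → b ∈ toList c → P (true , a , b)) →
  (∀ b → P (false , Vec.lookup u b , Vec.lookup c b)) →
  All P (literals v c u)
All-literals⁺ {P = P} v c u pos neg = All.++⁺
  (All.concat⁺ (All.map⁺ (All.tabulate λ a∈ → All.map⁺ (All.tabulate λ b∈ → pos a∈ b∈))))
  (All.map⁺ (AllV.toList⁺ (AllV.lookup⁻ λ b →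
    subst (λ (x , y) → P (false , x , y)) (sym (Vec.lookup-zip b u c)) (neg b))))

-- Choosing decreasing vectors

unique-lookup : ∀ {A : Set} {xs : List A} → Unique xs → ∀ i j →
  List.lookup xs i ≡ List.lookup xs j → i ≡ j
unique-lookup (_  ∷ _)   zero    zero    _  = refl
unique-lookup (x∉ ∷ _)   zero    (suc j) eq = ⊥-elim (All.lookup x∉ (∈-lookup j) eq)
unique-lookup (x∉ ∷ _)   (suc i) zero    eq = ⊥-elim (All.lookup x∉ (∈-lookup i) (sym eq))
unique-lookup (_  ∷ xs!) (suc i) (suc j) eq = cong suc (unique-lookup xs! i j eq)

-- Sending a position in `xs` to a position of the same element in `ys` is injective.
unique-length-≤ : ∀ {A : Set} {xs ys : List A} → Unique xs → (∀ {x} → x ∈ xs → x ∈ ys) →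
  length xs ≤ length ys
unique-length-≤ {xs = xs} {ys} xs! sub = Fin.injective⇒≤ {f = f} λ {i} {j} eq →
  unique-lookup xs! i j (begin
    List.lookup xs i     ≡⟨ Any.lookup-index (sub (∈-lookup i)) ⟩
    List.lookup ys (f i) ≡⟨ cong (List.lookup ys) eq ⟩
    List.lookup ys (f j) ≡⟨ Any.lookup-index (sub (∈-lookup j)) ⟨
    List.lookup xs j     ∎)
  where
  open ≡-Reasoning
  f : Fin (length xs) → Fin (length ys)
  f i = Any.index (sub (∈-lookup i))

prefix : ∀ {A : Set} {R : A → A → Set} {P : A → Set} d {xs} → d ≤ length xs → AllPairs R xs → All P xs →
  ∃ λ (v : Vec A d) → AllPairs R (toList v) × All P (toList v)
prefix zero    _          _         _          = [] , [] , []
prefix (suc d) (s≤s d≤l) (Rx ∷ Rxs) (px ∷ pxs)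
  -- The remaining entries must also be related to the first one, so this relation travels through
  -- the recursion as a part of `P`.
  with v , Rv , Rx∧pv ← prefix d d≤l Rxs (All.zip (Rx , pxs))
  with Rxv , pv ← All.unzip Rx∧pv
  = _ ∷ v , Rxv ∷ Rv , px ∷ pv

-- The order of `xs` is arbitrary, whereas `terms` wants decreasing vectors. So `xs` only shows that
-- enough elements satisfy `P`; the vector itself is a prefix of the descending enumeration of
-- `Fin m`, filtered by `P`.
choose : ∀ {m d} {P : Fin m → Set} → Decidable P → ∀ {xs} → Unique xs → All P xs → d ≤ length xs →
  ∃ λ (v : Vec (Fin m) d) → Decreasing v × All P (toList v)
choose {m} {d} P? {xs} xs! pxs d≤l =
  prefix d (ℕ.≤-trans d≤l (unique-length-≤ xs! found)) (AllPairs.filter⁺ P? descending)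
    (All.all-filter P? (List.tabulate opposite))
  where
  found : ∀ {i} → i ∈ xs → i ∈ filter P? (List.tabulate opposite)
  found {i} i∈ = ∈-filter⁺ P? (subst (_∈ List.tabulate opposite) (Fin.opposite-involutive i)
    (∈-tabulate⁺ (opposite i))) (All.lookup pxs i∈)
  descending : AllPairs Fin._>_ (List.tabulate {n = m} opposite)
  descending = AllPairs.tabulate⁺-< λ {i} {j} i<j → subst₂ _<_
    (sym (Fin.opposite-prop j)) (sym (Fin.opposite-prop i))
    (ℕ.∸-monoʳ-< (s≤s i<j) (Fin.toℕ<n j))

decreasing-unique : ∀ {m d} {v : Vec (Fin m) d} → Decreasing v → Unique (toList v)
decreasing-unique = AllPairs.map (λ { j<i refl → ℕ.<-irrefl refl j<i })

-- Rules and circuits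

family-satisfied⁻ : ∀ p q {m n} (x : Matrix m n → Bool) → eval (family p q m n) x ≡ true →
  ∃ λ t → t ∈ terms p q m n × Satisfied x (literalsOf t)
family-satisfied⁻ p q {m} {n} x eq =
  find (Any.reverse⁻ (Any.map⁻ (eval-dnf⁻ x (List.map literalsOf (reverse (terms p q m n))) eq)))

family-satisfied⁺ : ∀ {p q m n} (x : Matrix m n → Bool) {t} → t ∈ terms p q m n →
  Satisfied x (literalsOf t) → eval (family p q m n) x ≡ true
family-satisfied⁺ x t∈ sat = eval-dnf⁺ x (Any.map⁺ (Any.reverse⁺ (lose t∈ sat)))

-- A numeric attribute offers intervals only, so its single value is tested by a degenerate one.
present : ∀ A → IsBoolean A → Atomic A
present (categorical _ _) (c , _)       = is c
present (numeric _)       ((q , _) , _) = inside q q ℚ.≤-refl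

present-fulfilled : ∀ A (b : IsBoolean A) {d : Dom A} → is-just d ≡ true →
  Maybe.Any (Fulfils A (present A b)) d
present-fulfilled A b@(c , unique) {just v} _ with unique (just v)
present-fulfilled (categorical _ _) (c , _) {just .c} _ | inj₂ refl = Maybe.just refl
present-fulfilled (numeric _) (c , _) {just .c} _ | inj₂ refl = Maybe.just (ℚ.≤-refl , ℚ.≤-refl)

fulfilled-is-just : ∀ {A : Set} {P : A → Set} {d} → Maybe.Any P d → is-just d ≡ true
fulfilled-is-just (Maybe.just _) = refl

-- All non-null values equal `c`. So a condition that holds somewhere amounts to not being null, be
-- it an equation, an inequation or either kind of interval.
fulfilled-elsewhere : ∀ A → IsBoolean A → {P : Value A → Set} {d d′ : Dom A} → Maybe.Any P d →
  is-just d′ ≡ true → Maybe.Any P d′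
fulfilled-elsewhere A (_ , unique) {d′ = just v′} (Maybe.just {v} Pv) _
  with inj₂ refl ← unique (just v) | inj₂ refl ← unique (just v′) = Maybe.just Pv

length-filter-map : ∀ {A B : Set} {P : B → Set} (P? : Decidable P) (f : A → B) xs →
  length (filter P? (List.map f xs)) ≡ length (filter (P? ∘ f) xs)
length-filter-map P? f []       = refl
length-filter-map P? f (x ∷ xs) with does (P? (f x))
... | true  = cong suc (length-filter-map P? f xs)
... | false = length-filter-map P? f xs

-- Columns of rules and rows of databases

module _ {n} {I : Schema n} where

  columns : Conjunction I → List (Fin n)
  columns = List.map proj₁

  attributes-∈ : ∀ {j} (C : Conjunction I) →
    j Subset.∈ Subset.⋃ (List.map (λ a → Subset.⁅ proj₁ a ⁆) C) → j ∈ columns C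
  attributes-∈ []      j∈ = ⊥-elim (Subset.∉⊥ j∈)
  attributes-∈ (a ∷ C) j∈ with Subset.x∈p∪q⁻ Subset.⁅ proj₁ a ⁆ _ j∈
  ... | inj₁ j∈a = here (Subset.x∈⁅y⁆⇒x≡y (proj₁ a) j∈a)
  ... | inj₂ j∈C = there (attributes-∈ C j∈C)

  ∈-attributes : ∀ {j} (C : Conjunction I) → j ∈ columns C →
    j Subset.∈ Subset.⋃ (List.map (λ a → Subset.⁅ proj₁ a ⁆) C)
  ∈-attributes (a ∷ C) (here refl) = Subset.x∈p∪q⁺ (inj₁ (Subset.x∈⁅x⁆ (proj₁ a)))
  ∈-attributes (a ∷ C) (there j∈)  = Subset.x∈p∪q⁺ (inj₂ (∈-attributes C j∈))

  rule-columns-unique : (R : Rule I) → Unique (columns (Rule.body∧head R))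
  rule-columns-unique R = subst Unique (sym (List.map-++ proj₁ (conjuncts body) (conjuncts head)))
    (Unique.++⁺ (distinct body) (distinct head) λ (j∈B , j∈H) →
      disjoint (_ , Subset.x∈p∩q⁺ (∈-attributes (conjuncts body) j∈B , ∈-attributes (conjuncts head) j∈H)))
    where
    open Rule R
    open Condition

  nonempty-conjuncts : (C : Condition I) → Subset.⊥ Subset.⊂ Condition.attributes C →
    1 ≤ length (Condition.conjuncts C)
  nonempty-conjuncts C (_ , j , j∈ , _) with Condition.conjuncts C
  ... | []    = ⊥-elim (Subset.∉⊥ j∈)
  ... | _ ∷ _ = s≤s z≤n

  2≤ruleSize : (R : Rule I) → 2 ≤ ruleSize R
  2≤ruleSize R = ℕ.+-mono-≤ (nonempty-conjuncts body ∅⊂I-body) (nonempty-conjuncts head ∅⊂I-head)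
    where open Rule R

  -- The number `2 + (k ∸ 2)` is the maximum of `k` and 2; for `k` below 2, the nonempty body and
  -- head provide the two columns.
  columns-≥ : (R : Rule I) → ∀ k → k ≤ ruleSize R → 2 + (k ∸ 2) ≤ length (columns (Rule.body∧head R))
  columns-≥ R k k≤ = ℕ.≤-trans (larger k k≤) (ℕ.≤-reflexive (sym
    (trans (List.length-map proj₁ (Rule.body∧head R)) (List.length-++ (Condition.conjuncts (Rule.body R))))))
    where
    larger : ∀ k → k ≤ ruleSize R → 2 + (k ∸ 2) ≤ ruleSize R
    larger 0             _  = 2≤ruleSize R
    larger 1             _  = 2≤ruleSize R
    larger (suc (suc k)) k≤ = k≤

  -- Tuple I unfolds to a function type, from which I cannot be inferred.

  _⊩_ : Tuple I → AtomicCondition I → Set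
  _⊩_ = _⊨_ {n} {I}

  _⊩?_ : ∀ t a → Dec (t ⊩ a)
  _⊩?_ = _⊨?_ {n} {I}

  chosen : Conjunction I → Database I → Database I
  chosen = select {n} {I}

  satisfies? : ∀ C → Decidable (λ t → All (t ⊩_) C)
  satisfies? C t = all? (t ⊩?_) C

  module _ (D : Database I) where

    row-satisfies? : ∀ C → Decidable (λ i → All (List.lookup D i ⊩_) C)
    row-satisfies? C i = satisfies? C (List.lookup D i)

    -- Positions instead of tuples, since duplicates count separately in the support.
    chosenRows : Conjunction I → List (Fin (length D))
    chosenRows C = filter (row-satisfies? C) (allFin (length D))

    length-chosen : ∀ C → length (chosen C D) ≡ length (chosenRows C)
    length-chosen C = begin
      length (filter (satisfies? C) D)
        ≡⟨ cong (length ∘ filter (satisfies? C))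
             (trans (List.map-tabulate id (List.lookup D)) (List.tabulate-lookup D)) ⟨
      length (filter (satisfies? C) (List.map (List.lookup D) (allFin (length D))))
        ≡⟨ length-filter-map (satisfies? C) (List.lookup D) (allFin (length D)) ⟩
      length (chosenRows C) ∎
      where open ≡-Reasoning

    counterexample : ∀ a → ¬ (chosen [ a ] D ↭ D) → ∃ λ i → ¬ (List.lookup D i ⊩ a)
    counterexample a ≁ with all? (_⊩? a) D
    ... | yes all = ⊥-elim (≁ (↭-reflexive (List.filter-all (satisfies? [ a ]) (All.map (_∷ []) all))))
    ... | no ¬all = Any.index some , Any.lookup-index some
      where
      some : Any (λ t → ¬ (t ⊩ a)) D
      some = All.¬All⇒Any¬ (_⊩? a) D ¬all

    -- A violating row is dropped by the selection, which makes it shorter, while permutations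
    -- preserve length.
    not-everywhere : ∀ a i → ¬ (List.lookup D i ⊩ a) → ¬ (chosen [ a ] D ↭ D)
    not-everywhere a i ¬⊩ σ = ℕ.<⇒≢
      (List.filter-notAll (satisfies? [ a ]) D (lose (∈-lookup i) (λ { (⊩a ∷ []) → ¬⊩ ⊩a })))
      (↭-length σ)

  module _ (bool : ∀ j → IsBoolean (I j)) where

    present-at : Fin n → AtomicCondition I
    present-at j = j , present (I j) (bool j)

    columns-present : ∀ js → columns (List.map present-at js) ≡ js
    columns-present js = trans (sym (List.map-∘ js)) (List.map-id js)

    condition : (js : List (Fin n)) → Unique js → Condition I
    condition js js! = record
      { conjuncts = List.map present-at js
      ; distinct  = subst Unique (sym (columns-present js)) js!
      }

    ∈-condition : ∀ {j js} (js! : Unique js) → j ∈ js → j Subset.∈ Condition.attributes (condition js js!)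
    ∈-condition {j} {js} _ j∈ = ∈-attributes (List.map present-at js)
      (subst (j ∈_) (sym (columns-present js)) j∈)

    condition-∈ : ∀ {j js} (js! : Unique js) → j Subset.∈ Condition.attributes (condition js js!) → j ∈ js
    condition-∈ {j} {js} _ j∈ = subst (j ∈_) (columns-present js) (attributes-∈ (List.map present-at js) j∈)

    -- The first column forms the body and the others the head. Each of `c` and `c′` witnesses that
    -- its own side is nonempty and that the other side is a proper subset.
    rule : ∀ c c′ {cs} → Unique (c ∷ c′ ∷ cs) → Rule I
    rule c c′ {cs} c! = record
      { body      = condition [ c ] ([] ∷ [])
      ; head      = condition (c′ ∷ cs) (AllPairs.tail c!)
      ; ∅⊂I-body  = Subset.⊥⊆ , c , c∈body , Subset.∉⊥
      ; I-body⊂I  = Subset.⊆⊤ , c′ , Subset.∈⊤ , separate c′∈head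
      ; ∅⊂I-head  = Subset.⊥⊆ , c′ , c′∈head , Subset.∉⊥
      ; I-head⊂I  = Subset.⊆⊤ , c , Subset.∈⊤ , λ c∈ → separate c∈ c∈body
      ; disjoint  = λ (j , j∈) → let j∈B , j∈H = Subset.x∈p∩q⁻ _ _ j∈ in separate j∈H j∈B
      }
      where
      cs! : Unique (c′ ∷ cs)
      cs! = AllPairs.tail c!
      c∈body = ∈-condition {c} ([] ∷ []) (here refl)
      c′∈head = ∈-condition {c′} cs! (here refl)
      separate : ∀ {j} → j Subset.∈ Condition.attributes (condition (c′ ∷ cs) cs!) →
        ¬ (j Subset.∈ Condition.attributes (condition [ c ] ([] ∷ [])))
      separate j∈H j∈B with condition-∈ ([] ∷ []) j∈B
      ... | here refl = All.lookup (AllPairs.head c!) (condition-∈ cs! j∈H) refl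

    module _ (D : Database I) .{{_ : NonZero (length D)}} {s : ℚ} {p : ℕ}
      (threshold : ceiling (s ℚ.* (ℤ.+ length D / 1)) ≡ ℤ.+ suc p) where

      entries : Matrix (length D) n → Bool
      entries (i , j) = is-just (List.lookup D i j)

      module _ (k : ℕ) where

        q : ℕ
        q = 2 + (k ∸ 2)

        term⇒rule : ∀ {v : Vec (Fin (length D)) (suc p)} {c : Vec (Fin n) q} {u} →
          Decreasing v → Decreasing c →
          (∀ {i} → i ∈ toList v → ∀ {j} → j ∈ toList c → value entries (true , i , j) ≡ true) →
          (∀ b → value entries (false , Vec.lookup u b , Vec.lookup c b) ≡ true) →
          ⟨ I , D , sup , k , s ⟩
        -- `q` unfolds to 2 plus a number, so there is one column for the body and at least one for
        -- the head.
        term⇒rule {v} {c@(c₀ ∷ c₁ ∷ cs)} {u} v> c> ones zeros =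
          R , All.All¬⇒¬Any nontrivial , size-≥ , ≤-fraction⇐ threshold support-≥
          where
          R : Rule I
          R = rule c₀ c₁ (decreasing-unique c>)
          null : ∀ {b} → not b ≡ true → ¬ (b ≡ true)
          null {false} _ ()
          -- This list is the conjunction `body∧head` of `R` by computation. Row `u` at `b` is null
          -- in column `c` at `b`, so it violates the condition there.
          nontrivial : All (λ a → ¬ (chosen [ a ] D ↭ D)) (List.map present-at (toList c))
          nontrivial = All.map⁺ {f = present-at} (AllV.toList⁺ (AllV.lookup⁻ {xs = c} λ b →
            not-everywhere D (present-at (Vec.lookup c b)) (Vec.lookup u b) λ ⊩a →
              null (zeros b) (fulfilled-is-just ⊩a)))
          size-≥ : k ≤ ruleSize R
          size-≥ = ℕ.≤-trans (ℕ.m≤n+m∸n k 2) (ℕ.≤-reflexive (cong (λ l → 2 + l) (sym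
            (trans (List.length-map present-at (toList cs)) (Vec.length-toList cs)))))
          support-≥ : suc p ≤ length (chosen (List.map present-at (toList c)) D)
          support-≥ = begin
            suc p                   ≡⟨ Vec.length-toList v ⟨
            length (toList v)       ≤⟨ unique-length-≤ (decreasing-unique v>) (λ {i} i∈ →
              ∈-filter⁺ (row-satisfies? D (List.map present-at (toList c))) (∈-allFin i)
                (All.map⁺ {f = present-at} (All.tabulate {xs = toList c} λ {j} j∈ →
                  present-fulfilled (I j) (bool j) (ones i∈ j∈)))) ⟩
            length (chosenRows D (List.map present-at (toList c)))
                                    ≡⟨ length-chosen D (List.map present-at (toList c)) ⟨
            length (chosen (List.map present-at (toList c)) D) ∎
            where open ℕ.≤-Reasoning

        accepts⇒rule : eval (family (suc p) q (length D) n) entries ≡ true → ⟨ I , D , sup , k , s ⟩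
        accepts⇒rule eq =
          let (v , c , u) , t∈ , sat = family-satisfied⁻ (suc p) q entries eq
              v> , c>       = terms-∈ t∈
              ones , zeros  = All-literals⁻ v c u sat
          in term⇒rule {v} {c} {u} v> c> ones zeros

        module _ (C : Conjunction I) (nontrivial : All (λ a → ¬ (chosen [ a ] D ↭ D)) C)
          {v : Vec (Fin (length D)) (suc p)} {c : Vec (Fin n) q}
          (v-sat : All (λ i → All (List.lookup D i ⊩_) C) (toList v))
          (c∈ : All (_∈ columns C) (toList c)) where

          all-one : ∀ {i} → i ∈ toList v → ∀ {j} → j ∈ toList c → value entries (true , i , j) ≡ true
          all-one i∈ j∈ =
            let a , a∈ , j≡ = ∈-map⁻ proj₁ (All.lookup c∈ j∈)
            in subst (λ j → value entries (true , _ , j) ≡ true) (sym j≡)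
                 (fulfilled-is-just (All.lookup (All.lookup v-sat i∈) a∈))

          head-∈ : ∀ {A : Set} {l} (xs : Vec A (suc l)) → Vec.head xs ∈ toList xs
          head-∈ (_ ∷ _) = here refl

          not-true : ∀ {b} → ¬ (b ≡ true) → not b ≡ true
          not-true {false} _  = refl
          not-true {true}  ≢t = ⊥-elim (≢t refl)

          -- Non-triviality provides a row that violates the condition `a` on this column. The first
          -- row of `v`, which exists as `v` has `suc p` entries, satisfies `a`; were the entry of
          -- the violating row not null, `a` would hold there too.
          zero-row : ∀ b → ∃ λ i → value entries (false , i , Vec.lookup c b) ≡ true
          zero-row b =
            let a , a∈ , j≡ = ∈-map⁻ proj₁ (AllV.lookup⁺ (AllV.toList⁻ c∈) b)
                i , ¬⊩a     = counterexample D a (All.lookup nontrivial a∈)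
            in i , subst (λ j → value entries (false , i , j) ≡ true) (sym j≡) (not-true λ i-just →
                 ¬⊩a (fulfilled-elsewhere (I (proj₁ a)) (bool (proj₁ a))
                   (All.lookup (All.lookup v-sat (head-∈ v)) a∈) i-just))

        -- No smaller rule is built: `q` columns are taken directly from the given rule, and the
        -- rows that satisfy all of its conditions have ones in these columns.
        rule⇒accepts : ⟨ I , D , sup , k , s ⟩ → eval (family (suc p) q (length D) n) entries ≡ true
        rule⇒accepts (R , nontrivial , k≤size , s≤sup) =
          let v , v> , v-sat = choose (row-satisfies? D C)
                (Unique.filter⁺ (row-satisfies? D C) (Unique.allFin⁺ (length D)))
                (All.all-filter (row-satisfies? D C) (allFin (length D)))
                (subst (suc p ≤_) (length-chosen D C) (≤-fraction⇒ threshold s≤sup))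
              c , c> , c∈ = choose (λ j → Any.any? (j Fin.≟_) (columns C))
                (rule-columns-unique R) (All.tabulate id) (columns-≥ R k k≤size)
              nontrivial′ = All.¬Any⇒All¬ C nontrivial
              row b       = zero-row C nontrivial′ v-sat c∈ b
          in family-satisfied⁺ entries (∈-terms⁺ v> c> (Vec.tabulate (proj₁ ∘ row)))
               (All-literals⁺ v c (Vec.tabulate (proj₁ ∘ row)) (all-one C nontrivial′ v-sat c∈) λ b →
                 subst (λ i → value entries (false , i , Vec.lookup c b) ≡ true)
                   (sym (Vec.lookup∘tabulate (proj₁ ∘ row) b)) (proj₂ (row b)))
          where
          C : Conjunction I
          C = Rule.body∧head R

family-decides : ∀ k p → Decides (family (suc p) (2 + (k ∸ 2))) (supportProblem k (suc p))
family-decides k p x = mk⇔ (accepts⇒rule isBoolean D threshold k) (rule⇒accepts isBoolean D threshold k)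
  where open Input x

theorem6p4 : ∀ (k p : ℕ) → 1 ≤ k → 1 ≤ p → AC⁰[ 2 ] (supportProblem k p)
theorem6p4 k (suc p) _ _ = record
  { family         = family (suc p) (2 + (k ∸ 2))
  ; boundedDepth   = family-depth (suc p) (2 + (k ∸ 2))
  ; polynomialSize = family-polynomialSize p (suc (k ∸ 2))
  ; uniform        = family-uniform (suc p) (2 + (k ∸ 2))
  ; decides        = family-decides k p
  }
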